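{- Let $n\ge 3$. Suppose that the values of $\mathcal{P}_{n,G}$, for $G$ a connected graph on $n$ nodes with at most $\left\lfloor \frac{1}{2}\binom{n}{2}\right\rfloor$ edges, can be deduced from the values of $\mathcal{P}_{n,H}$ for $H$ ranging over the finite graphs (without isolated vertex) on at most $n-1$ nodes; that is, suppose that whenever two graphs $X,Y$ on $n$ nodes satisfy $\mathcal{P}_{n,H}(X)=\mathcal{P}_{n,H}(Y)$ for all such $H$, they satisfy $\mathcal{P}_{n,G}(X)=\mathcal{P}_{n,G}(Y)$ for all such $G$. Then finite graphs on $n$ nodes are reconstructible.
   Context: Graphs are finite, undirected, without loops or multiple edges. $\mathbb{K}$ is a field of characteristic $0$. Let $x_{ij}$, for integers $0<i<j$, be commuting variables; infinite formal sums of monomials are allowed. Reconstructibility: for a graph $X$ on $n\ge 3$ nodes, its multiset of vertex-deleted subgraphs is the multiset $\{X_1,\dots,X_n\}$ of isomorphism classes of the $n$ induced subgraphs obtained by deleting exactly one vertex. Graphs on $n$ nodes are reconstructible if any two graphs on $n$ nodes having the same multiset of vertex-deleted subgraphs are isomorphic. Action: for $\sigma \in \mathfrak{S}_m$ and $1\le i<j\le m$, $\sigma\cdot(i,j) := (\min(\sigma(i),\sigma(j)),\max(\sigma(i),\sigma(j)))$. Definition of $\mathcal{M}_G$: let $G$ be a graph on $m\ge 2$ vertices without isolated vertex. Choose any labeling of the vertices of $G$ by $1,\dots,m$ and let $a_{ij}\in\{0,1\}$ ($1\le i<j\le m$) be $1$ if and only if $i$ and $j$ are adjacent. Let $R\subset\mathfrak{S}_m$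 be a set of permutations such that the families $(a_{\sigma\cdot(i,j)})_{1\le i<j\le m}$, $\sigma\in R$, are pairwise distinct and exhaust all the families obtained for $\sigma\in\mathfrak{S}_m$. Then $$\mathcal{M}_G := \sum_{0<r_1<\dots<r_m}\ \sum_{\sigma\in R}\ \prod_{1\le i<j\le m} x_{r_i r_j}^{a_{\sigma\cdot(i,j)}} .$$ By convention the one-vertex graph $\bullet$ counts as a graph without isolated vertex, and $\mathcal{M}_\bullet:=1$. $\mathcal{P}_{n,G}\in\mathbb{K}[x_{ij}\mid 1\le i<j\le n]$ is the polynomial obtained from $\mathcal{M}_G$ by setting to $0$ every variable having an index greater than $n$. Evaluation: for a graph $X$ on $n$ vertices, choose a labeling of its vertices by $1,\dots,n$ and put $b_{ij}=1$ if $i<j$ are adjacent in $X$ and $b_{ij}=0$ otherwise; $\mathcal{P}_{n,G}(X)$ is the value at $x_{ij}=b_{ij}$, which does not depend on the labeling. -}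

module Defs where

open import Algebra.Bundles using (CommutativeRing)
import Algebra.Definitions as AlgebraDefinitions
import Algebra.Definitions.RawMonoid as RawMonoid
open import Data.Bool.Base using (Bool; true; false; T; if_then_else_)
open import Data.Bool.Properties using (T-≡)
open import Data.Fin.Base using (Fin; zero; suc; toℕ; fromℕ; fromℕ<; punchIn; _<_)
open import Data.Fin.Permutation
  using (Permutation′; _⟨$⟩ʳ_; _⟨$⟩ˡ_; insert; remove; insert-remove; insert-punchIn; inverseʳ; _∘ₚ_)
  renaming (id to idₚ; flip to inverse; _≈_ to _≗ₚ_)
open import Data.Fin.Properties using (_<?_; _≟_; toℕ-fromℕ; toℕ-injective; toℕ≤pred[n])
open import Data.List.Base
  using (List; []; _∷_; map; foldr; filter; concatMap; mapMaybe; replicate; _++_;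
         deduplicate; allFin; upTo; cartesianProduct)
open import Data.List.Membership.Propositional using (_∈_; lose)
open import Data.List.Membership.Propositional.Properties
  using (∈-allFin; ∈-concatMap⁺; ∈-filter⁺; ∈-cartesianProduct⁺)
open import Data.List.Properties using (map-cong)
import Data.List.Properties as List
import Data.List.Relation.Binary.Permutation.Setoid as Multiset
open import Data.List.Relation.Unary.All as All using (All; []; _∷_)
import Data.List.Relation.Unary.All.Properties as All
open import Data.List.Relation.Unary.AllPairs using (AllPairs)
open import Data.List.Relation.Unary.Any as Any using (Any; here; there)
import Data.List.Relation.Unary.Any.Properties as Any
open import Data.List.Relation.Unary.Unique.DecSetoid.Properties using (deduplicate-!)
open import Data.Maybe.Base using (Maybe; just; nothing; zipWith) renaming (map to mapₘ)
open import Data.Nat.Base as ℕ using (ℕ; zero; suc; pred; _≤_)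
open import Data.Nat.ListAction using (sum)
open import Data.Nat.Properties as ℕ using ()
open import Data.Product.Base using (Σ; ∃; _×_; _,_; proj₁; proj₂)
open import Data.Sum.Base using (_⊎_; inj₁; inj₂)
open import Data.Vec.Base using (Vec; lookup; _∷ʳ_) renaming ([] to []ᵥ; _∷_ to _∷ᵥ_)
open import Function.Base using (_∘_)
open import Function.Bundles using (module Equivalence)
open import Level using (Level; 0ℓ; _⊔_)
open import Relation.Binary.Bundles using (Setoid; DecSetoid)
import Relation.Binary.Construct.On as On
open import Relation.Binary.Construct.Closure.ReflexiveTransitive using (Star)
open import Relation.Binary.PropositionalEquality
  using (_≡_; _≢_; refl; sym; trans; cong; cong₂; subst; decSetoid)
open import Relation.Nullary using (¬_; yes; no; does; contradiction)
open import Relation.Nullary.Decidable using (dec⇒maybe)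

private
  variable
    m n : ℕ
    c ℓ : Level
    V W : Set

module _ (K : CommutativeRing c ℓ) where
  open CommutativeRing K
    using (Carrier; _≈_; _*_; 0#; 1#; +-rawMonoid)
  open AlgebraDefinitions _≈_ using (Invertible)
  open RawMonoid +-rawMonoid renaming (_×_ to _·_)

  record IsField : Set (c ⊔ ℓ) where
    field
      1≉0            : ¬ (1# ≈ 0#)
      ≉0⇒invertible  : ∀ x → ¬ (x ≈ 0#) → Invertible 1# _*_ x

  CharacteristicZero : Set ℓ
  CharacteristicZero = ∀ k → ¬ (suc k · 1# ≈ 0#)

record Graph (n : ℕ) : Set where
  field
    adj        : Fin n → Fin n → Bool
    adj-sym    : ∀ i j → adj i j ≡ adj j i
    adj-irrefl : ∀ i → adj i i ≡ false

open Graph public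

Adjacent : Graph n → Fin n → Fin n → Set
Adjacent X i j = T (adj X i j)

infix 4 _≅_

_≅_ : Graph n → Graph n → Set
_≅_ {n} X Y =
  Σ (Permutation′ n) λ π → ∀ i j → adj X i j ≡ adj Y (π ⟨$⟩ʳ i) (π ⟨$⟩ʳ j)

graphSetoid : ℕ → Setoid 0ℓ 0ℓ
graphSetoid n = record
  { Carrier       = Graph n
  ; _≈_           = _≅_
  ; isEquivalence = record
    { refl  = idₚ , λ _ _ → refl
    ; sym   = λ {X} {Y} (π , iso) → inverse π , λ i j →
        trans (cong₂ (adj Y) (sym (inverseʳ π)) (sym (inverseʳ π)))
              (sym (iso (π ⟨$⟩ˡ i) (π ⟨$⟩ˡ j)))
    ; trans = λ (π , iso) (ρ , iso′) → (π ∘ₚ ρ) , λ i j →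
        trans (iso i j) (iso′ (π ⟨$⟩ʳ i) (π ⟨$⟩ʳ j))
    }
  }

Connected : Graph n → Set
Connected X = ∀ u v → Star (Adjacent X) u v

-- The one-vertex graph counts as a graph without isolated vertex.
WithoutIsolatedVertex : Graph m → Set
WithoutIsolatedVertex {m} G = m ≡ 1 ⊎ (∀ v → ∃ λ w → Adjacent G v w)

pairs : ∀ m → List (Fin m × Fin m)
pairs m = filter (λ (i , j) → i <? j) (cartesianProduct (allFin m) (allFin m))

entry : Graph m → Fin m × Fin m → ℕ
entry G (i , j) = if adj G i j then 1 else 0

edgeCount : Graph n → ℕ
edgeCount X = sum (map (entry X) (pairs _))

infixl 6 _−_

_−_ : Graph n → Fin n → Graph (pred n)
_−_ {suc _} X v = record
  { adj        = λ i j → adj X (punchIn v i) (punchIn v j)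
  ; adj-sym    = λ i j → adj-sym X (punchIn v i) (punchIn v j)
  ; adj-irrefl = λ i → adj-irrefl X (punchIn v i)
  }

vertexDeleted : Graph n → List (Graph (pred n))
vertexDeleted X = map (X −_) (allFin _)

-- Equality of multisets of isomorphism classes: list permutation over the
-- setoid of graphs up to isomorphism.
SameVertexDeleted : Graph n → Graph n → Set
SameVertexDeleted {n} X Y = vertexDeleted X ↭ vertexDeleted Y
  where open Multiset (graphSetoid (pred n)) using (_↭_)

Reconstructible : ℕ → Set
Reconstructible n = ∀ (X Y : Graph n) → SameVertexDeleted X Y → X ≅ Y

-- A monomial is the list of its variables, repeated according to exponent; a
-- polynomial is a list of monomials, the coefficients being repetitions.
Monomial : Set → Set
Monomial V = List V

Polynomial : Set → Set
Polynomial V = List (Monomial V)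

-- S stands for the infinite formal sum S 0 + S 1 + S 2 + ⋯
FormalSum : Set → Set
FormalSum V = ℕ → Polynomial V

-- `nothing` means that the variable is set to 0.
substituteMonomial : (V → Maybe W) → Monomial V → Maybe (Monomial W)
substituteMonomial s = foldr (λ v → zipWith _∷_ (s v)) (just [])

substitute : (V → Maybe W) → Polynomial V → Polynomial W
substitute s = mapMaybe (substituteMonomial s)

-- Indices are numbered from 0: the pair (i , j) is the variable usually written
-- x with indices i+1, j+1.  Only pairs with i < j are ever used.
keepVariable : ∀ n → ℕ × ℕ → Maybe (Fin n × Fin n)
keepVariable n (i , j) = zipWith _,_ (index i) (index j)
  where
  index : ℕ → Maybe (Fin n)
  index k = mapₘ (λ k<n → fromℕ< k<n) (dec⇒maybe (k ℕ.<? n))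

permutations : ∀ m → List (Permutation′ m)
permutations zero    = idₚ ∷ []
permutations (suc m) =
  concatMap (λ j → map (insert zero j) (permutations m)) (allFin (suc m))

act : Permutation′ m → Fin m × Fin m → Fin m × Fin m
act σ (i , j) =
  if does (σ ⟨$⟩ʳ i <? σ ⟨$⟩ʳ j)
  then (σ ⟨$⟩ʳ i , σ ⟨$⟩ʳ j)
  else (σ ⟨$⟩ʳ j , σ ⟨$⟩ʳ i)

family : Graph m → Permutation′ m → List ℕ
family G σ = map (entry G ∘ act σ) (pairs _)

familyDecSetoid : Graph m → DecSetoid 0ℓ 0ℓ
familyDecSetoid G = On.decSetoid (decSetoid (List.≡-dec ℕ._≟_)) (family G)

representatives : Graph m → List (Permutation′ m)
representatives {m} G = deduplicate (DecSetoid._≟_ (familyDecSetoid G)) (permutations m)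

-- The strictly increasing sequences of length m with all values < N.
increasing : (m N : ℕ) → List (Vec ℕ m)
increasing zero    N       = []ᵥ ∷ []
increasing (suc m) zero    = []
increasing (suc m) (suc N) = increasing (suc m) N ++ map (_∷ʳ N) (increasing m N)

permutations-complete : (σ : Permutation′ m) → Any (σ ≗ₚ_) (permutations m)
permutations-complete {zero}  σ = here λ ()
permutations-complete {suc m} σ =
  Any.concatMap⁺ _ (lose (∈-allFin (σ ⟨$⟩ʳ zero))
    (Any.map⁺ (Any.map extend (permutations-complete (remove zero σ)))))
  where
  extend : ∀ {τ} → remove zero σ ≗ₚ τ → σ ≗ₚ insert zero (σ ⟨$⟩ʳ zero) τ
  extend         eq zero    = refl
  extend {τ = τ} eq (suc k) =
    trans (sym (insert-remove zero σ (suc k)))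
      (trans (insert-punchIn zero (σ ⟨$⟩ʳ zero) (remove zero σ) k)
        (trans (cong (punchIn (σ ⟨$⟩ʳ zero)) (eq k))
          (sym (insert-punchIn zero (σ ⟨$⟩ʳ zero) τ k))))

representatives-distinct : (G : Graph m) →
  AllPairs (λ σ τ → family G σ ≢ family G τ) (representatives G)
representatives-distinct {m} G = deduplicate-! (familyDecSetoid G) (permutations m)

representatives-exhaust : (G : Graph m) (σ : Permutation′ m) →
  Any (λ τ → family G σ ≡ family G τ) (representatives G)
representatives-exhaust G σ =
  Any.deduplicate⁺ (DecSetoid._≟_ (familyDecSetoid G)) (λ p q → trans q (sym p))
    (Any.map (λ {τ} → family-cong {τ}) (permutations-complete σ))
  where
  act-cong : ∀ {τ} → σ ≗ₚ τ → ∀ p → act σ p ≡ act τ p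
  act-cong eq (i , j) rewrite eq i | eq j = refl

  family-cong : ∀ {τ} → σ ≗ₚ τ → family G σ ≡ family G τ
  family-cong {τ} eq = map-cong (λ p → cong (entry G) (act-cong {τ} eq p)) (pairs _)

monomial : Graph m → Vec ℕ m → Permutation′ m → Monomial (ℕ × ℕ)
monomial G r σ =
  concatMap (λ (i , j) → replicate (entry G (act σ (i , j))) (lookup r i , lookup r j))
            (pairs _)

-- ℳ G N collects the terms whose last index r is N.  The value at the graph
-- with no vertices is never used.
ℳ : Graph m → FormalSum (ℕ × ℕ)
ℳ {suc (suc k)} G N       =
  concatMap (λ r → map (monomial G r) (representatives G)) (map (_∷ʳ N) (increasing (suc k) N))
ℳ               _ zero    = [] ∷ []
ℳ               _ (suc _) = []

-- The parts ℳ G N with N ≥ n contribute nothing, see `substitute-vanishes`.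
𝒫 : ∀ n → Graph m → Polynomial (Fin n × Fin n)
𝒫 n G = concatMap (λ N → substitute (keepVariable n) (ℳ G N)) (upTo n)

private
  substituteMonomial-nothing : (s : V → Maybe W) {v : V} {μ : Monomial V} →
    v ∈ μ → s v ≡ nothing → substituteMonomial s μ ≡ nothing
  substituteMonomial-nothing s {μ = _ ∷ μ} (here refl) eq rewrite eq = refl
  substituteMonomial-nothing s {μ = w ∷ μ} (there v∈μ) eq
    rewrite substituteMonomial-nothing s v∈μ eq with s w
  ... | just _  = refl
  ... | nothing = refl

  substitute-nothing : (s : V → Maybe W) {p : Polynomial V} →
    All (λ μ → substituteMonomial s μ ≡ nothing) p → substitute s p ≡ []
  substitute-nothing s []         = refl
  substitute-nothing s (eq ∷ eqs) rewrite eq = substitute-nothing s eqs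

  keepVariable-nothing : ∀ {N} i → n ≤ N → keepVariable n (i , N) ≡ nothing
  keepVariable-nothing {n} {N} i n≤N with i ℕ.<? n | N ℕ.<? n
  ... | _     | yes N<n = contradiction N<n (ℕ.≤⇒≯ n≤N)
  ... | yes _ | no _    = refl
  ... | no _  | no _    = refl

  lookup-last : ∀ {k} (r : Vec ℕ k) N → lookup (r ∷ʳ N) (fromℕ k) ≡ N
  lookup-last []ᵥ      N = refl
  lookup-last (_ ∷ᵥ r) N = lookup-last r N

  act-neighbour : (G : Graph m) (σ : Permutation′ m) (i j : Fin m) →
    Adjacent G (σ ⟨$⟩ʳ j) (σ ⟨$⟩ʳ i) → entry G (act σ (i , j)) ≡ 1
  act-neighbour G σ i j a with does (σ ⟨$⟩ʳ i <? σ ⟨$⟩ʳ j)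
  ... | true  rewrite adj-sym G (σ ⟨$⟩ʳ i) (σ ⟨$⟩ʳ j) | Equivalence.to T-≡ a = refl
  ... | false rewrite Equivalence.to T-≡ a = refl

  last-occurs : ∀ {k} (G : Graph (suc k)) → (∀ v → ∃ λ w → Adjacent G v w) →
    ∀ r N σ → ∃ λ i → (i , N) ∈ monomial G (r ∷ʳ N) σ
  last-occurs {k} G noIso r N σ =
    lookup (r ∷ʳ N) i ,
    ∈-concatMap⁺ _ {xs = pairs (suc k)} (lose
      (∈-filter⁺ (λ (i , j) → i <? j)
        (∈-cartesianProduct⁺ (∈-allFin i) (∈-allFin last)) i<last)
      occurs)
    where
    last i : Fin (suc k)
    last = fromℕ k
    w    = proj₁ (noIso (σ ⟨$⟩ʳ last))
    i    = σ ⟨$⟩ˡ w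

    adjacent : Adjacent G (σ ⟨$⟩ʳ last) (σ ⟨$⟩ʳ i)
    adjacent = subst (Adjacent G (σ ⟨$⟩ʳ last)) (sym (inverseʳ σ))
                 (proj₂ (noIso (σ ⟨$⟩ʳ last)))

    i≢last : i ≢ last
    i≢last eq = subst T
      (trans (cong (λ v → adj G (σ ⟨$⟩ʳ last) (σ ⟨$⟩ʳ v)) eq) (adj-irrefl G _)) adjacent

    i<last : i < last
    i<last = ℕ.≤∧≢⇒<
      (subst (toℕ i ≤_) (sym (toℕ-fromℕ k)) (toℕ≤pred[n] i)) (i≢last ∘ toℕ-injective)

    occurs : (lookup (r ∷ʳ N) i , N) ∈
      replicate (entry G (act σ (i , last))) (lookup (r ∷ʳ N) i , lookup (r ∷ʳ N) last)
    occurs rewrite act-neighbour G σ i last adjacent =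
      here (cong (lookup (r ∷ʳ N) i ,_) (sym (lookup-last r N)))

substitute-vanishes : (G : Graph m) → 2 ≤ m → WithoutIsolatedVertex G →
  ∀ N → n ≤ N → substitute (keepVariable n) (ℳ G N) ≡ []
substitute-vanishes {suc (suc k)} {n} G _ (inj₂ noIso) N n≤N =
  substitute-nothing (keepVariable n)
    (All.concat⁺ (All.map⁺ (All.map⁺ (All.universal (λ r →
      All.map⁺ (All.universal (λ σ →
        let i , i∈μ = last-occurs G noIso r N σ in
        substituteMonomial-nothing (keepVariable n) i∈μ (keepVariable-nothing i n≤N))
      (representatives G)))
    (increasing (suc k) N)))))
substitute-vanishes {suc (suc _)} _ _ (inj₁ ()) _ _
substitute-vanishes {suc zero} _ (ℕ.s≤s ()) _ _ _

module _ (K : CommutativeRing c ℓ) where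
  open CommutativeRing K using (Carrier; _+_; _*_; 0#; 1#)

  eval : Polynomial V → (V → Carrier) → Carrier
  eval p b = foldr _+_ 0# (map (λ μ → foldr _*_ 1# (map b μ)) p)

  value : Polynomial (Fin n × Fin n) → Graph n → Carrier
  value p X = eval p (λ (i , j) → if adj X i j then 1# else 0#)

{-# OPTIONS --safe #-}

-- Summing over the vertex-deleted subgraphs counts a map into X missing d
-- vertices d times, so for any finite pattern the number of non-surjective maps of
-- that pattern into X is reconstructible (Kelly's lemma).  Since 𝒫 (n, H)(X), times
-- the number of automorphisms of H, counts the injective homomorphisms H → X, all
-- values for H on fewer than n nodes are reconstructible.
-- Let X and Y have the same vertex-deleted subgraphs.  They have equally many
-- edges, so it suffices to find a bijective homomorphism X → Y; and passing to the
-- complements we may assume that X has at most half of the possible edges.  If X is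
-- connected, the hypothesis for G = X and 𝒫 (n, X)(X) ≠ 0 give 𝒫 (n, X)(Y) ≠ 0.  If
-- X = A ⊔ B, then hom (X, Z) = hom (A, Z) hom (B, Z) is reconstructible by Kelly's
-- lemma; subtracting the non-surjective homomorphisms leaves the bijective ones, so
-- there are as many of these into Y as into X.
module Submission where

open import Defs
open import Algebra.Bundles using (CommutativeRing)
import Algebra.Properties.CommutativeSemigroup as CommutativeSemigroup
import Algebra.Properties.Monoid.Mult as Mult
open import Data.Bool.Base using (Bool; true; false; T; if_then_else_; not; _∧_)
open import Data.Bool.Properties as Bool using (T?; not-involutive)
open import Data.Fin.Base as Fin using (Fin; zero; suc; punchIn; punchOut; toℕ; fromℕ)
open import Data.Fin.Permutation
  using (Permutation′; _⟨$⟩ʳ_; _⟨$⟩ˡ_; inverseˡ; inverseʳ; permutation)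
  renaming (id to idₚ; flip to inverse)
open import Data.Fin.Properties as Fin
  using (_≟_; _<?_; all?; any?; punchIn-injective; punchInᵢ≢i; punchOut-injective;
         pigeonhole; toℕ<n; fromℕ<-toℕ)
open import Data.Fin.Subset using (Subset; _∈_; _∉_; _∪_; ⁅_⁆; _⊃_)
open import Data.Fin.Subset.Induction using (Acc; acc; ⊃-wellFounded)
open import Data.Fin.Subset.Properties
  using (_∈?_; x∈⁅x⁆; x∈⁅y⁆⇒x≡y; p⊆p∪q; x∈p∪q⁺; x∈p∪q⁻)
open import Data.List.Base as List using (List; []; _∷_; _++_; concatMap)
open import Data.List.Membership.Propositional using () renaming (_∈_ to _∈ᴸ_)
open import Data.List.Membership.Propositional.Properties
  using (∈-allFin; ∈-filter⁺; ∈-cartesianProduct⁺)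
open import Data.List.Properties as List using (∷-injectiveˡ; ∷-injectiveʳ; upTo-∷ʳ)
import Data.List.Relation.Binary.Permutation.Homogeneous as Permutation
open import Data.List.Relation.Binary.Pointwise using ([]; _∷_)
open import Data.List.Relation.Unary.All as Allᴸ using ([]; _∷_) renaming (All to Allᴸ)
import Data.List.Relation.Unary.All.Properties as Allᴸ
open import Data.List.Relation.Unary.AllPairs as AllPairsᴸ
  using ([]; _∷_) renaming (AllPairs to AllPairsᴸ)
open import Data.List.Relation.Unary.Any as Any using (Any; here; there)
open import Data.Maybe.Base using (Maybe; just; nothing; maybe; zipWith)
open import Data.Nat.Base
  using (ℕ; zero; suc; pred; _+_; _*_; _∸_; _≤_; _<_; z≤n; s≤s; s≤s⁻¹; ≢-nonZero;
         ⌊_/2⌋; _!)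
open import Data.Nat.Combinatorics using (_C_; nC1≡n; nCk+nC[k+1]≡[n+1]C[k+1])
open import Data.Nat.DivMod using (_/_; m*[n/m]≡n)
open import Data.Nat.Divisibility using (∣-trans; m∣m*n; m≤n⇒m!∣n!)
import Data.Nat.ListAction as ListAction
open import Data.Nat.Properties as ℕ using (+-*-semiring)
open import Data.Product.Base using (Σ; ∃; _×_; _,_; proj₁; proj₂; uncurry)
open import Data.Sum.Base using (_⊎_; inj₁; inj₂; [_,_]′)
open import Data.Vec.Base as Vec using (Vec; []; _∷_; lookup; insertAt)
open import Data.Vec.Properties
  using (lookup-map; lookup-allFin; []=⇒lookup; lookup⇒[]=; map-insertAt; map-∘; map-cong)
open import Data.Vec.Relation.Unary.All as All using (All; []; _∷_)
import Data.Vec.Relation.Unary.All.Properties as All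
open import Data.Vec.Relation.Unary.AllPairs as AllPairs using ([]; _∷_)
open import Data.Vec.Relation.Unary.Unique.Propositional using (Unique)
open import Data.Vec.Relation.Unary.Unique.Propositional.Properties
  using (lookup-injective; map⁺; tabulate⁺)
open import Function.Base using (_∘_; id; _$_)
open import Function.Bundles using (mk⇔)
open import Relation.Binary.Bundles using (Setoid)
open import Relation.Binary.Construct.Closure.ReflexiveTransitive
  using (Star; ε; _◅◅_; _◅_; reverse)
open import Relation.Binary.Definitions using (tri<; tri≈; tri>)
open import Relation.Binary.PropositionalEquality
  using (_≡_; _≢_; refl; sym; trans; cong; cong₂; subst; _≗_; module ≡-Reasoning)
open import Relation.Nullary using (Dec; yes; no; ¬_; does; contradiction)
open import Relation.Nullary.Decidable
  using (¬?; _×-dec_; _→-dec_; does-⇔; decidable-stable)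
open import Relation.Unary using (Decidable)

open import Algebra.Properties.Semiring.Sum +-*-semiring
  using (sum; sum-cong-≗; sum-replicate-zero; sum-remove; sum-permute; sum-syntax;
         ∑-distrib-+; ∑-comm; *-distribˡ-sum; *-distribʳ-sum)
open CommutativeSemigroup ℕ.+-commutativeSemigroup
  using () renaming (interchange to +-interchange; x∙yz≈y∙xz to x+[y+z]≡y+[x+z])
open CommutativeSemigroup ℕ.*-commutativeSemigroup
  using () renaming (x∙yz≈y∙xz to x*[y*z]≡y*[x*z])

open ≡-Reasoning

private
  variable
    A B U V W P Q R : Set
    k l m n : ℕ

-- Finite sums

-- The Iverson bracket; all counting below is done with sums of such brackets in ℕ.
⟦_⟧ : Dec P → ℕ
⟦ p ⟧ = if does p then 1 else 0

⟦⟧-cong : (p : Dec P) (q : Dec Q) → (P → Q) → (Q → P) → ⟦ p ⟧ ≡ ⟦ q ⟧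
⟦⟧-cong p q f g = cong (if_then 1 else 0) (does-⇔ (mk⇔ f g) p q)

⟦⟧-× : (p : Dec P) (q : Dec Q) (r : Dec R) → (P → Q × R) → (Q × R → P) →
  ⟦ p ⟧ ≡ ⟦ q ⟧ * ⟦ r ⟧
⟦⟧-× p q r f g = trans (⟦⟧-cong p (q ×-dec r) f g) (if-∧ (does q) (does r))
  where
  if-∧ : ∀ a b → (if a ∧ b then 1 else 0) ≡ (if a then 1 else 0) * (if b then 1 else 0)
  if-∧ true  true  = refl
  if-∧ true  false = refl
  if-∧ false b     = refl

⟦⟧-yes : (p : Dec P) → P → ⟦ p ⟧ ≡ 1
⟦⟧-yes (yes _) _ = refl
⟦⟧-yes (no ¬p) p = contradiction p ¬p

⟦⟧-no : (p : Dec P) → ¬ P → ⟦ p ⟧ ≡ 0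
⟦⟧-no (yes p) ¬p = contradiction p ¬p
⟦⟧-no (no _)  _  = refl

⟦⟧-witness : (p : Dec P) → ⟦ p ⟧ ≢ 0 → P
⟦⟧-witness (yes p) _ = p
⟦⟧-witness (no _)  ≢ = contradiction refl ≢

⟦⟧*-cong : (p : Dec P) {a b : ℕ} → (P → a ≡ b) → ⟦ p ⟧ * a ≡ ⟦ p ⟧ * b
⟦⟧*-cong (yes p) eq = cong (1 *_) (eq p)
⟦⟧*-cong (no _)  _  = refl

*≢0ˡ : ∀ {a b} → a * b ≢ 0 → a ≢ 0
*≢0ˡ ab≢0 refl = ab≢0 refl

*≢0ʳ : ∀ a {b} → a * b ≢ 0 → b ≢ 0
*≢0ʳ a ab≢0 refl = ab≢0 (ℕ.*-zeroʳ a)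

term≤sum : (f : Fin n → ℕ) (i : Fin n) → f i ≤ sum f
term≤sum {suc n} f i = subst (f i ≤_) (sym (sum-remove {i = i} f)) (ℕ.m≤m+n (f i) _)

sum-witness : (f : Fin n → ℕ) → sum f ≢ 0 → ∃ λ i → f i ≢ 0
sum-witness {zero}  f ≢0 = contradiction refl ≢0
sum-witness {suc n} f ≢0 with f zero ℕ.≟ 0
... | no  f0≢0 = zero , f0≢0
... | yes f0≡0 with sum-witness (f ∘ suc) (λ eq → ≢0 (cong₂ _+_ f0≡0 eq))
...   | i , fi≢0 = suc i , fi≢0

∑ᴸ : List A → (A → ℕ) → ℕ
∑ᴸ xs φ = ListAction.sum (List.map φ xs)

-- A vector in `Vec (Fin n) m` stands for a map from `Fin m` to `Fin n`, so this is the sum over all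
-- such maps. The vector encoding turns it into an iterated finite sum.
∑ᵛ : ∀ m → (Vec (Fin n) m → ℕ) → ℕ
∑ᵛ zero    φ = φ []
∑ᵛ (suc m) φ = ∑[ i < _ ] ∑ᵛ m (λ f → φ (i ∷ f))

∑ᵛ-cong : ∀ m {φ ψ : Vec (Fin n) m → ℕ} → φ ≗ ψ → ∑ᵛ m φ ≡ ∑ᵛ m ψ
∑ᵛ-cong zero    eq = eq []
∑ᵛ-cong (suc m) eq = sum-cong-≗ λ i → ∑ᵛ-cong m (eq ∘ (i ∷_))

∑ᵛ-zero : ∀ m → ∑ᵛ {n} m (λ _ → 0) ≡ 0
∑ᵛ-zero     zero    = refl
∑ᵛ-zero {n} (suc m) = trans (sum-cong-≗ {n} λ _ → ∑ᵛ-zero m) (sum-replicate-zero n)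

∑ᵛ-+ : ∀ m (φ ψ : Vec (Fin n) m → ℕ) → ∑ᵛ m (λ f → φ f + ψ f) ≡ ∑ᵛ m φ + ∑ᵛ m ψ
∑ᵛ-+ zero    φ ψ = refl
∑ᵛ-+ (suc m) φ ψ = trans
  (sum-cong-≗ λ i → ∑ᵛ-+ m (φ ∘ (i ∷_)) (ψ ∘ (i ∷_)))
  (∑-distrib-+ (λ i → ∑ᵛ m (φ ∘ (i ∷_))) _)

∑ᵛ-* : ∀ m c (φ : Vec (Fin n) m → ℕ) → ∑ᵛ m (λ f → c * φ f) ≡ c * ∑ᵛ m φ
∑ᵛ-* zero    c φ = refl
∑ᵛ-* (suc m) c φ = trans
  (sum-cong-≗ λ i → ∑ᵛ-* m c (φ ∘ (i ∷_)))
  (sym (*-distribˡ-sum c (λ i → ∑ᵛ m (φ ∘ (i ∷_)))))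

∑ᵛ-*ʳ : ∀ m c (φ : Vec (Fin n) m → ℕ) → ∑ᵛ m (λ f → φ f * c) ≡ ∑ᵛ m φ * c
∑ᵛ-*ʳ m c φ = trans (∑ᵛ-cong m λ f → ℕ.*-comm (φ f) c)
  (trans (∑ᵛ-* m c φ) (ℕ.*-comm c _))

∑ᵛ-∑ : ∀ m (φ : Fin k → Vec (Fin n) m → ℕ) →
  ∑ᵛ m (λ f → ∑[ i < k ] φ i f) ≡ ∑[ i < k ] ∑ᵛ m (φ i)
∑ᵛ-∑         zero    φ = refl
∑ᵛ-∑ {k} {n} (suc m) φ = trans
  (sum-cong-≗ {n} λ j → ∑ᵛ-∑ m (λ i f → φ i (j ∷ f)))
  (∑-comm {n} {k} (λ j i → ∑ᵛ m (λ f → φ i (j ∷ f))))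

∑ᵛ-∑ᴸ : ∀ m (xs : List A) (φ : A → Vec (Fin n) m → ℕ) →
  ∑ᵛ m (λ f → ∑ᴸ xs (λ x → φ x f)) ≡ ∑ᴸ xs (λ x → ∑ᵛ m (φ x))
∑ᵛ-∑ᴸ m []       φ = ∑ᵛ-zero m
∑ᵛ-∑ᴸ m (x ∷ xs) φ = trans (∑ᵛ-+ m (φ x) _) (cong (∑ᵛ m (φ x) +_) (∑ᵛ-∑ᴸ m xs φ))

∑ᵛ-permute : ∀ m (π : Permutation′ n) (φ : Vec (Fin n) m → ℕ) →
  ∑ᵛ m (λ f → φ (Vec.map (π ⟨$⟩ʳ_) f)) ≡ ∑ᵛ m φ
∑ᵛ-permute zero    π φ = refl
∑ᵛ-permute (suc m) π φ = trans
  (sum-cong-≗ λ i → ∑ᵛ-permute m π (λ f → φ ((π ⟨$⟩ʳ i) ∷ f)))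
  (sym (sum-permute (λ i → ∑ᵛ m (φ ∘ (i ∷_))) π))

Fresh : Fin n → Vec (Fin n) m → Set
Fresh v = All (v ≢_)

fresh? : (v : Fin n) (f : Vec (Fin n) m) → Dec (Fresh v f)
fresh? v = All.all? (λ i → ¬? (v ≟ i))

fresh-∷ : ∀ (v : Fin n) i (f : Vec (Fin n) m) →
  ⟦ fresh? v (i ∷ f) ⟧ ≡ ⟦ ¬? (v ≟ i) ⟧ * ⟦ fresh? v f ⟧
fresh-∷ v i f = ⟦⟧-× (fresh? v (i ∷ f)) (¬? (v ≟ i)) (fresh? v f) All.uncons (λ (p , ps) → p ∷ ps)

sum-punchIn : ∀ (v : Fin (suc n)) (φ : Fin (suc n) → ℕ) →
  ∑[ i < n ] φ (punchIn v i) ≡ ∑[ i < suc n ] (⟦ ¬? (v ≟ i) ⟧ * φ i)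
sum-punchIn v φ = sym $ trans (sum-remove {i = v} (λ i → ⟦ ¬? (v ≟ i) ⟧ * φ i)) $ cong₂ _+_
  (cong (_* φ v) (⟦⟧-no (¬? (v ≟ v)) (λ v≢v → v≢v refl)))
  (sum-cong-≗ λ i → trans
    (cong (_* φ (punchIn v i)) (⟦⟧-yes (¬? (v ≟ punchIn v i)) (punchInᵢ≢i v i ∘ sym)))
    (ℕ.*-identityˡ _))

-- Composition with `punchIn v` is a bijection from the maps into `Fin n` onto the maps into
-- `Fin (suc n)` that avoid v. This is how maps into `X − v` become maps into X.
∑ᵛ-punchIn : ∀ m (v : Fin (suc n)) (φ : Vec (Fin (suc n)) m → ℕ) →
  ∑ᵛ m (λ f → φ (Vec.map (punchIn v) f)) ≡ ∑ᵛ m (λ f → ⟦ fresh? v f ⟧ * φ f)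
∑ᵛ-punchIn     zero    v φ = sym (ℕ.*-identityˡ _)
∑ᵛ-punchIn {n} (suc m) v φ = begin
  ∑[ i < n ] ∑ᵛ m (λ f → φ (punchIn v i ∷ Vec.map (punchIn v) f))
    ≡⟨ sum-cong-≗ (λ i → ∑ᵛ-punchIn m v (φ ∘ (punchIn v i ∷_))) ⟩
  ∑[ i < n ] ∑ᵛ m (λ f → ⟦ fresh? v f ⟧ * φ (punchIn v i ∷ f))
    ≡⟨ sum-punchIn v (λ i → ∑ᵛ m (λ f → ⟦ fresh? v f ⟧ * φ (i ∷ f))) ⟩
  ∑[ i < suc n ] (⟦ ¬? (v ≟ i) ⟧ * ∑ᵛ m (λ f → ⟦ fresh? v f ⟧ * φ (i ∷ f)))
    ≡⟨ sum-cong-≗ (λ i → sym (∑ᵛ-* m ⟦ ¬? (v ≟ i) ⟧ (λ f → ⟦ fresh? v f ⟧ * φ (i ∷ f)))) ⟩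
  ∑[ i < suc n ] ∑ᵛ m (λ f → ⟦ ¬? (v ≟ i) ⟧ * (⟦ fresh? v f ⟧ * φ (i ∷ f)))
    ≡⟨ sum-cong-≗ (λ i → ∑ᵛ-cong m λ f → trans
         (sym (ℕ.*-assoc ⟦ ¬? (v ≟ i) ⟧ _ _)) (cong (_* φ (i ∷ f)) (sym (fresh-∷ v i f)))) ⟩
  ∑[ i < suc n ] ∑ᵛ m (λ f → ⟦ fresh? v (i ∷ f) ⟧ * φ (i ∷ f)) ∎

term≤∑ᵛ : ∀ {m} (φ : Vec (Fin n) m → ℕ) f → φ f ≤ ∑ᵛ m φ
term≤∑ᵛ φ []      = ℕ.≤-refl
term≤∑ᵛ φ (i ∷ f) = ℕ.≤-trans (term≤∑ᵛ (φ ∘ (i ∷_)) f) (term≤sum (λ i → ∑ᵛ _ (φ ∘ (i ∷_))) i)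

∑ᵛ-witness : ∀ m (φ : Vec (Fin n) m → ℕ) → ∑ᵛ m φ ≢ 0 → ∃ λ f → φ f ≢ 0
∑ᵛ-witness zero    φ ≢0 = [] , ≢0
∑ᵛ-witness (suc m) φ ≢0 with sum-witness _ ≢0
... | i , ≢0′ with ∑ᵛ-witness m (φ ∘ (i ∷_)) ≢0′
...   | f , φf≢0 = i ∷ f , φf≢0

∑ᵛ-≢0 : ∀ {m} (φ : Vec (Fin n) m → ℕ) f → φ f ≢ 0 → ∑ᵛ m φ ≢ 0
∑ᵛ-≢0 φ f φf≢0 eq = φf≢0 (ℕ.n≤0⇒n≡0 (subst (φ f ≤_) eq (term≤∑ᵛ φ f)))

∑ᴸ-tabulate : (g : Fin n → A) (φ : A → ℕ) → ∑ᴸ (List.tabulate g) φ ≡ ∑[ i < n ] φ (g i)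
∑ᴸ-tabulate {zero}  g φ = refl
∑ᴸ-tabulate {suc n} g φ = cong (φ (g zero) +_) (∑ᴸ-tabulate (g ∘ suc) φ)

∑ᴸ-map : (g : A → B) (xs : List A) (φ : B → ℕ) → ∑ᴸ (List.map g xs) φ ≡ ∑ᴸ xs (φ ∘ g)
∑ᴸ-map g []       φ = refl
∑ᴸ-map g (x ∷ xs) φ = cong (φ (g x) +_) (∑ᴸ-map g xs φ)

∑ᴸ-++ : (xs ys : List A) (φ : A → ℕ) → ∑ᴸ (xs ++ ys) φ ≡ ∑ᴸ xs φ + ∑ᴸ ys φ
∑ᴸ-++ []       ys φ = refl
∑ᴸ-++ (x ∷ xs) ys φ = trans (cong (φ x +_) (∑ᴸ-++ xs ys φ)) (sym (ℕ.+-assoc (φ x) _ _))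

∑ᴸ-concatMap : (g : A → List B) (xs : List A) (φ : B → ℕ) →
  ∑ᴸ (concatMap g xs) φ ≡ ∑ᴸ xs (λ x → ∑ᴸ (g x) φ)
∑ᴸ-concatMap g []       φ = refl
∑ᴸ-concatMap g (x ∷ xs) φ = trans (∑ᴸ-++ (g x) _ φ) (cong (∑ᴸ (g x) φ +_) (∑ᴸ-concatMap g xs φ))

∑ᴸ-cong : (xs : List A) {φ ψ : A → ℕ} → φ ≗ ψ → ∑ᴸ xs φ ≡ ∑ᴸ xs ψ
∑ᴸ-cong []       eq = refl
∑ᴸ-cong (x ∷ xs) eq = cong₂ _+_ (eq x) (∑ᴸ-cong xs eq)

∑ᴸ-+ : (xs : List A) (φ ψ : A → ℕ) → ∑ᴸ xs (λ x → φ x + ψ x) ≡ ∑ᴸ xs φ + ∑ᴸ xs ψ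
∑ᴸ-+ []       φ ψ = refl
∑ᴸ-+ (x ∷ xs) φ ψ = trans (cong (φ x + ψ x +_) (∑ᴸ-+ xs φ ψ)) (+-interchange (φ x) (ψ x) _ _)

∑ᴸ-filter : {P : A → Set} (P? : Decidable P) (xs : List A) (φ : A → ℕ) →
  ∑ᴸ (List.filter P? xs) φ ≡ ∑ᴸ xs (λ x → ⟦ P? x ⟧ * φ x)
∑ᴸ-filter P? []       φ = refl
∑ᴸ-filter P? (x ∷ xs) φ with P? x
... | yes _ = cong₂ _+_ (sym (ℕ.*-identityˡ (φ x))) (∑ᴸ-filter P? xs φ)
... | no  _ = ∑ᴸ-filter P? xs φ

∑ᴸ-cartesianProduct : (xs : List A) (ys : List B) (φ : A × B → ℕ) →
  ∑ᴸ (List.cartesianProduct xs ys) φ ≡ ∑ᴸ xs (λ x → ∑ᴸ ys (λ y → φ (x , y)))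
∑ᴸ-cartesianProduct []       ys φ = refl
∑ᴸ-cartesianProduct (x ∷ xs) ys φ = trans (∑ᴸ-++ (List.map (x ,_) ys) _ φ)
  (cong₂ _+_ (∑ᴸ-map (x ,_) ys φ) (∑ᴸ-cartesianProduct xs ys φ))

∑-∑ᴸ : (xs : List A) (φ : Fin k → A → ℕ) →
  ∑[ i < k ] ∑ᴸ xs (φ i) ≡ ∑ᴸ xs (λ x → ∑[ i < k ] φ i x)
∑-∑ᴸ {k = k} []       φ = sum-replicate-zero k
∑-∑ᴸ {k = k} (x ∷ xs) φ = trans (∑-distrib-+ (λ i → φ i x) _)
  (cong (∑[ i < k ] φ i x +_) (∑-∑ᴸ xs φ))

∑ᴸ-* : ∀ c (xs : List A) (φ : A → ℕ) → ∑ᴸ xs (λ x → c * φ x) ≡ c * ∑ᴸ xs φ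
∑ᴸ-* c []       φ = sym (ℕ.*-zeroʳ c)
∑ᴸ-* c (x ∷ xs) φ = trans (cong (c * φ x +_) (∑ᴸ-* c xs φ)) (sym (ℕ.*-distribˡ-+ c (φ x) _))

-- Existence and pairwise exclusion together give exactly one entry. The lists in question are those
-- of the representatives of relabellings.
∑ᴸ-unique : {P : A → Set} (P? : Decidable P) {xs : List A} → Any P xs →
  AllPairsᴸ (λ x y → P x → ¬ P y) xs → ∑ᴸ xs (λ x → ⟦ P? x ⟧) ≡ 1
∑ᴸ-unique {A} {P} P? (here {x} px) (¬ps ∷ _) =
  cong₂ _+_ (⟦⟧-yes (P? x) px) (none (Allᴸ.map (λ f → f px) ¬ps))
  where
  none : ∀ {xs} → Allᴸ (λ x → ¬ P x) xs → ∑ᴸ xs (λ x → ⟦ P? x ⟧) ≡ 0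
  none []                 = refl
  none (_∷_ {y} ¬p ¬ps) = cong₂ _+_ (⟦⟧-no (P? y) ¬p) (none ¬ps)
∑ᴸ-unique P? (there {x} any) (¬ps ∷ pairs) =
  cong₂ _+_ (⟦⟧-no (P? x) λ px → conflict px any ¬ps) (∑ᴸ-unique P? any pairs)
  where
  conflict : ∀ {A : Set} {P : A → Set} {x : A} {xs} → P x → Any P xs →
    ¬ Allᴸ (λ y → P x → ¬ P y) xs
  conflict px (here py)   (f ∷ _)  = f px py
  conflict px (there any) (_ ∷ fs) = conflict px any fs

-- Kelly's lemma

Injective : (A → B) → Set
Injective ρ = ∀ {x y} → ρ x ≡ ρ y → x ≡ y

permutation-injective : (π : Permutation′ n) → Injective (π ⟨$⟩ʳ_)
permutation-injective π eq = trans (sym (inverseˡ π)) (trans (cong (π ⟨$⟩ˡ_) eq) (inverseˡ π))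

fresh-map : {ρ : Fin k → Fin l} → Injective ρ → ∀ v (f : Vec (Fin k) m) →
  ⟦ fresh? (ρ v) (Vec.map ρ f) ⟧ ≡ ⟦ fresh? v f ⟧
fresh-map {ρ = ρ} inj v f = ⟦⟧-cong (fresh? (ρ v) (Vec.map ρ f)) (fresh? v f)
  (λ fr → All.map (_∘ cong ρ) (All.map⁻ fr))
  (λ fr → All.map⁺ (All.map (_∘ inj) fr))

-- The number of elements outside the image; it is 0 exactly for the surjective maps.
missed : Vec (Fin n) m → ℕ
missed f = ∑[ v < _ ] ⟦ fresh? v f ⟧

missed-permute : (π : Permutation′ n) (f : Vec (Fin n) m) →
  missed (Vec.map (π ⟨$⟩ʳ_) f) ≡ missed f
missed-permute π f = trans
  (sum-permute (λ v → ⟦ fresh? v (Vec.map (π ⟨$⟩ʳ_) f) ⟧) π)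
  (sum-cong-≗ λ v → fresh-map (permutation-injective π) v f)

missed-punchIn : ∀ v (f : Vec (Fin n) m) → missed (Vec.map (punchIn v) f) ≡ suc (missed f)
missed-punchIn v f = trans
  (sum-remove {i = v} (λ w → ⟦ fresh? w (Vec.map (punchIn v) f) ⟧))
  (cong₂ _+_
    (⟦⟧-yes (fresh? v (Vec.map (punchIn v) f))
      (All.map⁺ (All.universal (λ i → punchInᵢ≢i v i ∘ sym) f)))
    (sum-cong-≗ λ w → fresh-map (punchIn-injective v _ _) w f))

⟦⟧≤1 : (p : Dec P) → ⟦ p ⟧ ≤ 1
⟦⟧≤1 (yes _) = ℕ.≤-refl
⟦⟧≤1 (no _)  = z≤n

sum≤n : (f : Fin n → ℕ) → (∀ i → f i ≤ 1) → sum f ≤ n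
sum≤n {zero}  f f≤1 = z≤n
sum≤n {suc n} f f≤1 = ℕ.+-mono-≤ (f≤1 zero) (sum≤n (f ∘ suc) (f≤1 ∘ suc))

missed≤n : (f : Vec (Fin n) m) → missed f ≤ n
missed≤n f = sum≤n _ λ v → ⟦⟧≤1 (fresh? v f)

-- All that is used of the hypothesis that X and Y have the same vertex-deleted
-- subgraphs.
record SameDeckSums (X Y : Graph (suc n)) : Set where
  field
    deck-sum : (F : Graph n → ℕ) → (∀ Z Z′ → Z ≅ Z′ → F Z ≡ F Z′) →
      ∑[ v < suc n ] F (X − v) ≡ ∑[ v < suc n ] F (Y − v)

open SameDeckSums

-- The graph may have any size, so that one weight serves a graph and its vertex-deleted subgraphs
-- alike.
Weight : ℕ → Set
Weight m = ∀ {k} → Graph k → Vec (Fin k) m → ℕ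

-- Invariance under induced embeddings. It contains invariance under isomorphism (ρ a permutation)
-- and the passage from `X − v` to X (ρ the map `punchIn v`).
Natural : Weight m → Set
Natural P = ∀ {k l} (Z : Graph k) (X : Graph l) (ρ : Fin k → Fin l) → Injective ρ →
  (∀ i j → adj Z i j ≡ adj X (ρ i) (ρ j)) → ∀ f → P Z f ≡ P X (Vec.map ρ f)

module _ (P : Weight m) (P-natural : Natural P) where

  -- A map into X missing e + 1 vertices is a map into e + 1 of the graphs X − v,
  -- where it misses e vertices; the weight (n + 1)! / (e + 1) compensates for this.
  private
    compensated : ℕ → ℕ → ℕ
    compensated n e = suc n ! / suc e

    compensate : ∀ n d c → d ≤ suc n →
      d * (c * compensated n (pred d)) ≡ suc n ! * (c * ⟦ 1 ℕ.≤? d ⟧)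
    -- For a surjective map `pred 0` is the meaningless value 0, but the factor d = 0 removes the
    -- term.
    compensate n zero    c _   = sym (trans (cong (suc n ! *_) (ℕ.*-zeroʳ c)) (ℕ.*-zeroʳ (suc n !)))
    compensate n (suc e) c e<n = begin
      suc e * (c * (suc n ! / suc e))  ≡⟨ ℕ.*-assoc (suc e) c _ ⟨
      suc e * c * (suc n ! / suc e)    ≡⟨ cong (_* (suc n ! / suc e)) (ℕ.*-comm (suc e) c) ⟩
      c * suc e * (suc n ! / suc e)    ≡⟨ ℕ.*-assoc c (suc e) _ ⟩
      c * (suc e * (suc n ! / suc e))
        -- The division is exact: e + 1 divides (e + 1)!, which divides (n + 1)! because e + 1 ≤ n +
        -- 1.
        ≡⟨ cong (c *_) (m*[n/m]≡n (∣-trans (m∣m*n (e !)) (m≤n⇒m!∣n! e<n))) ⟩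
      c * suc n !                      ≡⟨ ℕ.*-comm c _ ⟩
      suc n ! * c                      ≡⟨ cong (suc n ! *_) (ℕ.*-identityʳ c) ⟨
      suc n ! * (c * 1)                ∎

    cardCount : ∀ n → Graph n → ℕ
    cardCount n Z = ∑ᵛ m (λ g → P Z g * compensated n (missed g))

    cardCount-≅ : ∀ (Z Z′ : Graph n) → Z ≅ Z′ → cardCount n Z ≡ cardCount n Z′
    cardCount-≅ {n} Z Z′ (π , iso) = trans
      (∑ᵛ-cong m λ g → cong₂ (λ a b → a * compensated n b)
        (P-natural Z Z′ (π ⟨$⟩ʳ_) (permutation-injective π) iso g)
        (sym (missed-permute π g)))
      (∑ᵛ-permute m π (λ g → P Z′ g * compensated n (missed g)))

    -- Double counting of the pairs of a vertex v and a map f that misses v. Each f occurs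
    -- `missed f` times, and as a map into `X − v` it misses one vertex fewer, whence the `pred`.
    sum-cardCount : (X : Graph (suc n)) →
      ∑[ v < suc n ] cardCount n (X − v)
        ≡ suc n ! * ∑ᵛ m (λ f → P X f * ⟦ 1 ℕ.≤? missed f ⟧)
    sum-cardCount {n} X = begin
      ∑[ v < suc n ] cardCount n (X − v)
        ≡⟨ sum-cong-≗ (λ v → ∑ᵛ-cong m λ g → cong₂ (λ a b → a * compensated n b)
             (P-natural (X − v) X (punchIn v) (punchIn-injective v _ _) (λ _ _ → refl) g)
             (cong pred (sym (missed-punchIn v g)))) ⟩
      ∑[ v < suc n ] ∑ᵛ m (λ g → term (Vec.map (punchIn v) g))
        ≡⟨ sum-cong-≗ (λ v → ∑ᵛ-punchIn m v term) ⟩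
      ∑[ v < suc n ] ∑ᵛ m (λ f → ⟦ fresh? v f ⟧ * term f)
        ≡⟨ ∑ᵛ-∑ m (λ v f → ⟦ fresh? v f ⟧ * term f) ⟨
      ∑ᵛ m (λ f → ∑[ v < suc n ] (⟦ fresh? v f ⟧ * term f))
        ≡⟨ ∑ᵛ-cong m (λ f → sym (*-distribʳ-sum (term f) (λ v → ⟦ fresh? v f ⟧))) ⟩
      ∑ᵛ m (λ f → missed f * term f)
        ≡⟨ ∑ᵛ-cong m (λ f → compensate n (missed f) (P X f) (missed≤n f)) ⟩
      ∑ᵛ m (λ f → suc n ! * (P X f * ⟦ 1 ℕ.≤? missed f ⟧))
        ≡⟨ ∑ᵛ-* m (suc n !) (λ f → P X f * ⟦ 1 ℕ.≤? missed f ⟧) ⟩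
      suc n ! * ∑ᵛ m (λ f → P X f * ⟦ 1 ℕ.≤? missed f ⟧) ∎
      where
      term : Vec (Fin (suc n)) m → ℕ
      term f = P X f * compensated n (pred (missed f))

  -- The invariant `cardCount` has the same sum over both families of vertex-deleted subgraphs; the
  -- nonzero factor (n + 1)! then cancels.
  kelly : {X Y : Graph (suc n)} → SameDeckSums X Y →
    ∑ᵛ m (λ f → P X f * ⟦ 1 ℕ.≤? missed f ⟧) ≡ ∑ᵛ m (λ f → P Y f * ⟦ 1 ℕ.≤? missed f ⟧)
  kelly {n} {X} {Y} same = ℕ.*-cancelˡ-≡ _ _ (suc n !) {{ ℕ._!≢0 (suc n) }} (begin
    suc n ! * ∑ᵛ m (λ f → P X f * ⟦ 1 ℕ.≤? missed f ⟧)  ≡⟨ sum-cardCount X ⟨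
    ∑[ v < suc n ] cardCount n (X − v)                  ≡⟨ deck-sum same (cardCount n) cardCount-≅ ⟩
    ∑[ v < suc n ] cardCount n (Y − v)                  ≡⟨ sum-cardCount Y ⟩
    suc n ! * ∑ᵛ m (λ f → P Y f * ⟦ 1 ℕ.≤? missed f ⟧)  ∎)

covers : (f : Vec (Fin n) m) → missed f ≡ 0 → ∀ v → ∃ λ i → lookup f i ≡ v
covers f missed≡0 v with any? (λ i → lookup f i ≟ v)
... | yes found = found
... | no ¬found = contradiction
  (subst (_≤ 0) (⟦⟧-yes (fresh? v f) (All.lookup⁻ λ i eq → ¬found (i , sym eq)))
    (subst (⟦ fresh? v f ⟧ ≤_) missed≡0 (term≤sum (λ w → ⟦ fresh? w f ⟧) v)))
  λ ()

-- If nothing were missed, choosing preimages would give a map from `Fin n` to the smaller `Fin m`;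
-- by the pigeonhole principle two distinct vertices would share a preimage.
missed-positive : m < n → (f : Vec (Fin n) m) → 1 ≤ missed f
missed-positive m<n f with missed f in eq
... | suc _ = s≤s z≤n
... | zero  with pigeonhole m<n (proj₁ ∘ covers f eq)
...   | i , j , i<j , eq′ = contradiction
  (trans (sym (proj₂ (covers f eq i))) (trans (cong (lookup f) eq′) (proj₂ (covers f eq j))))
  (Fin.<⇒≢ i<j)

-- No map from at most n points covers n + 1 vertices, so the restriction to non-surjective maps in
-- `kelly` is vacuous.
kelly-small : (P : Weight m) → Natural P → m ≤ n → {X Y : Graph (suc n)} →
  SameDeckSums X Y → ∑ᵛ m (P X) ≡ ∑ᵛ m (P Y)
kelly-small {m} {n} P P-natural m≤n {X} {Y} same =
  trans (restrict X) (trans (kelly P P-natural same) (sym (restrict Y)))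
  where
  restrict : ∀ X → ∑ᵛ m (P X) ≡ ∑ᵛ m (λ f → P X f * ⟦ 1 ℕ.≤? missed f ⟧)
  restrict X = ∑ᵛ-cong m λ f → trans (sym (ℕ.*-identityʳ (P X f)))
    (cong (P X f *_) (sym (⟦⟧-yes (1 ℕ.≤? missed f) (missed-positive (s≤s m≤n) f))))

-- Homomorphisms

injective⇒permutation : (f : Fin n → Fin n) → Injective f →
  Σ (Permutation′ n) λ π → ∀ i → π ⟨$⟩ʳ i ≡ f i
injective⇒permutation f inj =
  permutation f (λ v → proj₁ (surj f inj v)) (λ v → proj₂ (surj f inj v))
    (λ i → inj (proj₂ (surj f inj (f i)))) ,
  λ _ → refl
  where
  surj : ∀ {n} (f : Fin n → Fin n) → Injective f → ∀ v → ∃ λ i → f i ≡ v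
  surj {suc n} f inj v with any? (λ i → f i ≟ v)
  ... | yes found = found
  -- If v is not a value of f, `punchOut` removes it from the codomain, which leaves an injection
  -- into a set with one element fewer.
  ... | no ¬found with pigeonhole (ℕ.n<1+n n) (λ i → punchOut {i = v} {f i} λ eq → ¬found (i , sym eq))
  ...   | i , j , i<j , eq = contradiction
    (inj (punchOut-injective {i = v} (λ eq → ¬found (i , sym eq)) (λ eq → ¬found (j , sym eq)) eq))
    (Fin.<⇒≢ i<j)

-- A section of f is injective, hence a permutation, and f is the inverse of that permutation.
surjective⇒permutation : (f : Fin n → Fin n) → (∀ v → ∃ λ i → f i ≡ v) →
  Σ (Permutation′ n) λ π → ∀ i → π ⟨$⟩ʳ i ≡ f i
surjective⇒permutation f surj with injective⇒permutation (proj₁ ∘ surj)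
  (λ {v} {w} eq → trans (sym (proj₂ (surj v))) (trans (cong f eq) (proj₂ (surj w))))
... | π , π≗ = inverse π , λ i → begin
  π ⟨$⟩ˡ i                              ≡⟨ proj₂ (surj (π ⟨$⟩ˡ i)) ⟨
  f (proj₁ (surj (π ⟨$⟩ˡ i)))           ≡⟨ cong f (π≗ (π ⟨$⟩ˡ i)) ⟨
  f (π ⟨$⟩ʳ (π ⟨$⟩ˡ i))                 ≡⟨ cong f (inverseʳ π) ⟩
  f i                                   ∎

-- Source and target are bare Boolean relations: the source may be a part or a relabelling of a
-- graph, and the target may live on ℕ, as `extend X` does.
Hom : (Fin m → Fin m → Bool) → (W → W → Bool) → Vec W m → Set
Hom B A f = ∀ i j → T (B i j) → T (A (lookup f i) (lookup f j))

hom? : (B : Fin m → Fin m → Bool) (A : W → W → Bool) (f : Vec W m) → Dec (Hom B A f)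
hom? B A f = all? λ i → all? λ j → T? (B i j) →-dec T? (A (lookup f i) (lookup f j))

homWeight : (Fin m → Fin m → Bool) → Weight m
homWeight B Z f = ⟦ hom? B (adj Z) f ⟧

homWeight-natural : (B : Fin m → Fin m → Bool) → Natural (homWeight B)
homWeight-natural B Z X ρ _ emb f =
  ⟦⟧-cong (hom? B (adj Z) f) (hom? B (adj X) (Vec.map ρ f))
    (λ h i j b → subst T (adj-map i j) (h i j b))
    (λ h i j b → subst T (sym (adj-map i j)) (h i j b))
  where
  adj-map : ∀ i j → adj Z (lookup f i) (lookup f j)
                  ≡ adj X (lookup (Vec.map ρ f) i) (lookup (Vec.map ρ f) j)
  adj-map i j = trans (emb _ _) (sym (cong₂ (adj X) (lookup-map i ρ f) (lookup-map j ρ f)))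

identity-hom : (X : Graph n) → Hom (adj X) (adj X) (Vec.allFin n)
identity-hom X i j b rewrite lookup-allFin i | lookup-allFin j = b

-- Bijective homomorphisms between graphs with equally many edges

⟦⟧-mono : (p : Dec P) (q : Dec Q) → (P → Q) → ⟦ p ⟧ ≤ ⟦ q ⟧
⟦⟧-mono (yes p) q f = ℕ.≤-reflexive (sym (⟦⟧-yes q (f p)))
⟦⟧-mono (no _)  q f = z≤n

sum-mono : (f g : Fin n → ℕ) → (∀ i → f i ≤ g i) → sum f ≤ sum g
sum-mono {zero}  f g f≤g = z≤n
sum-mono {suc n} f g f≤g = ℕ.+-mono-≤ (f≤g zero) (sum-mono (f ∘ suc) (g ∘ suc) (f≤g ∘ suc))

-- Apart from index i the terms of f are at most those of g, so they can be cancelled from the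
-- inequality of the sums, which leaves `g i ≤ f i`.
sum-mono-≡ : (f g : Fin n → ℕ) → (∀ i → f i ≤ g i) → sum g ≤ sum f → f ≗ g
sum-mono-≡ {suc n} f g f≤g ∑g≤∑f i = ℕ.≤-antisym (f≤g i) (ℕ.+-cancelʳ-≤ _ _ _ (ℕ.≤-trans
  (ℕ.+-monoʳ-≤ (g i) (sum-mono _ _ (f≤g ∘ punchIn i)))
  (subst (_≤ f i + sum (f ∘ punchIn i)) (sum-remove {i = i} g)
    (subst (sum g ≤_) (sum-remove {i = i} f) ∑g≤∑f))))

edgeSum : Graph n → ℕ
edgeSum X = ∑[ i < _ ] ∑[ j < _ ] ⟦ T? (adj X i j) ⟧

⟦T⟧-injective : ∀ {a b} → ⟦ T? a ⟧ ≡ ⟦ T? b ⟧ → a ≡ b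
⟦T⟧-injective {true}  {true}  _ = refl
⟦T⟧-injective {false} {false} _ = refl

-- A bijective homomorphism embeds the edges of X into those of Y; equal numbers of edges leave no
-- room for a further edge of Y.
bijective-hom⇒≅ : {X Y : Graph n} → edgeSum X ≡ edgeSum Y → (π : Permutation′ n) →
  (∀ i j → Adjacent X i j → Adjacent Y (π ⟨$⟩ʳ i) (π ⟨$⟩ʳ j)) → X ≅ Y
bijective-hom⇒≅ {n} {X} {Y} same π hom = π , λ i j → ⟦T⟧-injective
  -- Rows first, then entries: equal totals force equal row sums, and these force equality entry by
  -- entry.
  (sum-mono-≡ _ _ (mono i) (ℕ.≤-reflexive (sym
    (sum-mono-≡ (λ i → ∑[ j < n ] x i j) _ (λ i → sum-mono _ _ (mono i)) (ℕ.≤-reflexive totals) i))) j)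
  where
  x y : Fin n → Fin n → ℕ
  x i j = ⟦ T? (adj X i j) ⟧
  y i j = ⟦ T? (adj Y (π ⟨$⟩ʳ i) (π ⟨$⟩ʳ j)) ⟧

  mono : ∀ i j → x i j ≤ y i j
  mono i j = ⟦⟧-mono (T? (adj X i j)) (T? (adj Y (π ⟨$⟩ʳ i) (π ⟨$⟩ʳ j))) (hom i j)

  totals : ∑[ i < n ] ∑[ j < n ] y i j ≡ ∑[ i < n ] ∑[ j < n ] x i j
  totals = trans
    (sum-cong-≗ λ i → sym (sum-permute (λ w → ⟦ T? (adj Y (π ⟨$⟩ʳ i) w) ⟧) π))
    (trans (sym (sum-permute (λ v → ∑[ w < n ] ⟦ T? (adj Y v w) ⟧) π)) (sym same))

-- `edgeSum` is a sum over the maps from two points, and `kelly-small` covers two points as soon as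
-- the graphs have at least three vertices.
edgeSum-reconstructible : 2 ≤ n → {X Y : Graph (suc n)} → SameDeckSums X Y → edgeSum X ≡ edgeSum Y
edgeSum-reconstructible 2≤n = kelly-small edge edge-natural 2≤n
  where
  edge : Weight 2
  edge Z (i ∷ j ∷ []) = ⟦ T? (adj Z i j) ⟧

  edge-natural : Natural edge
  edge-natural Z X ρ _ emb (i ∷ j ∷ []) = cong (λ b → ⟦ T? b ⟧) (emb i j)

-- Disconnected graphs

-- A partition of `Fin m` into a set of k and a set of l elements, as a shuffle: reading from 0
-- upwards, each element goes to the left or to the right.
data Split : ℕ → ℕ → ℕ → Set where
  []    : Split 0 0 0
  left  : Split k l m → Split (suc k) l (suc m)
  right : Split k l m → Split k (suc l) (suc m)

inˡ : Split k l m → Fin k → Fin m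
inˡ (left s)  zero    = zero
inˡ (left s)  (suc i) = suc (inˡ s i)
inˡ (right s) i       = suc (inˡ s i)

inʳ : Split k l m → Fin l → Fin m
inʳ (left s)  j       = suc (inʳ s j)
inʳ (right s) zero    = zero
inʳ (right s) (suc j) = suc (inʳ s j)

side : (s : Split k l m) (v : Fin m) → (∃ λ i → inˡ s i ≡ v) ⊎ (∃ λ j → inʳ s j ≡ v)
side (left s)  zero    = inj₁ (zero , refl)
side (right s) zero    = inj₂ (zero , refl)
side (left s)  (suc v) with side s v
... | inj₁ (i , eq) = inj₁ (suc i , cong suc eq)
... | inj₂ (j , eq) = inj₂ (j , cong suc eq)
side (right s) (suc v) with side s v
... | inj₁ (i , eq) = inj₁ (i , cong suc eq)
... | inj₂ (j , eq) = inj₂ (suc j , cong suc eq)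

sizes : Split k l m → k + l ≡ m
sizes []                = refl
sizes (left s)          = cong suc (sizes s)
sizes (right {k} {l} s) = trans (ℕ.+-suc k l) (cong suc (sizes s))

split : (c : Vec Bool m) → ∃ λ k → ∃ λ l → Σ (Split k l m) λ s →
  (∀ i → lookup c (inˡ s i) ≡ true) × (∀ j → lookup c (inʳ s j) ≡ false)
split []         = 0 , 0 , [] , (λ ()) , λ ()
split (true ∷ c)  with split c
... | _ , _ , s , inside , outside =
  _ , _ , left s , (λ { zero → refl ; (suc i) → inside i }) , outside
split (false ∷ c) with split c
... | _ , _ , s , inside , outside =
  _ , _ , right s , inside , λ { zero → refl ; (suc j) → outside j }

merge : Split k l m → Vec A k → Vec A l → Vec A m
merge []        []      []      = []
merge (left s)  (x ∷ f) g       = x ∷ merge s f g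
merge (right s) f       (y ∷ g) = y ∷ merge s f g

lookup-mergeˡ : ∀ (s : Split k l m) (f : Vec A k) g i →
  lookup (merge s f g) (inˡ s i) ≡ lookup f i
lookup-mergeˡ (left s)  (x ∷ f) g       zero    = refl
lookup-mergeˡ (left s)  (x ∷ f) g       (suc i) = lookup-mergeˡ s f g i
lookup-mergeˡ (right s) f       (y ∷ g) i       = lookup-mergeˡ s f g i

lookup-mergeʳ : ∀ (s : Split k l m) (f : Vec A k) g j →
  lookup (merge s f g) (inʳ s j) ≡ lookup g j
lookup-mergeʳ (left s)  (x ∷ f) g       j       = lookup-mergeʳ s f g j
lookup-mergeʳ (right s) f       (y ∷ g) zero    = refl
lookup-mergeʳ (right s) f       (y ∷ g) (suc j) = lookup-mergeʳ s f g j

-- A map on a disjoint union is a pair of maps on its two parts.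
∑ᵛ-merge : (s : Split k l m) (φ : Vec (Fin n) m → ℕ) →
  ∑ᵛ m φ ≡ ∑ᵛ k (λ f → ∑ᵛ l (λ g → φ (merge s f g)))
∑ᵛ-merge []              φ = refl
∑ᵛ-merge (left s)        φ = sum-cong-≗ λ i → ∑ᵛ-merge s (φ ∘ (i ∷_))
∑ᵛ-merge {k} (right s)   φ = trans
  (sum-cong-≗ λ i → ∑ᵛ-merge s (φ ∘ (i ∷_)))
  (sym (∑ᵛ-∑ k λ i f → ∑ᵛ _ (λ g → φ (i ∷ merge s f g))))

homCount : (Fin m → Fin m → Bool) → Graph n → ℕ
homCount B Z = ∑ᵛ _ (homWeight B Z)

module _ (G : Graph m) (s : Split k l m) (apart : ∀ i j → ¬ Adjacent G (inˡ s i) (inʳ s j)) where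

  private
    Gˡ : Fin k → Fin k → Bool
    Gˡ i j = adj G (inˡ s i) (inˡ s j)

    Gʳ : Fin l → Fin l → Bool
    Gʳ i j = adj G (inʳ s i) (inʳ s j)

  module _ (A : W → W → Bool) (f : Vec W k) (g : Vec W l) where

    hom-merge⁻ : Hom (adj G) A (merge s f g) → Hom Gˡ A f × Hom Gʳ A g
    hom-merge⁻ h =
      (λ i j b → subst T (cong₂ A (lookup-mergeˡ s f g i) (lookup-mergeˡ s f g j)) (h _ _ b)) ,
      (λ i j b → subst T (cong₂ A (lookup-mergeʳ s f g i) (lookup-mergeʳ s f g j)) (h _ _ b))

    -- Every edge lies within one side, since `apart` excludes the mixed cases; so the conditions on
    -- the two sides suffice.
    hom-merge⁺ : Hom Gˡ A f × Hom Gʳ A g → Hom (adj G) A (merge s f g)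
    hom-merge⁺ (hˡ , hʳ) v w b with side s v | side s w
    ... | inj₁ (i , refl) | inj₁ (j , refl) =
      subst T (sym (cong₂ A (lookup-mergeˡ s f g i) (lookup-mergeˡ s f g j))) (hˡ i j b)
    ... | inj₂ (i , refl) | inj₂ (j , refl) =
      subst T (sym (cong₂ A (lookup-mergeʳ s f g i) (lookup-mergeʳ s f g j))) (hʳ i j b)
    ... | inj₁ (i , refl) | inj₂ (j , refl) = contradiction b (apart i j)
    ... | inj₂ (i , refl) | inj₁ (j , refl) =
      contradiction (subst T (adj-sym G _ _) b) (apart j i)

  homCount-split : (Z : Graph n) → homCount (adj G) Z ≡ homCount Gˡ Z * homCount Gʳ Z
  homCount-split Z = begin
    ∑ᵛ m (homWeight (adj G) Z)
      ≡⟨ ∑ᵛ-merge s (homWeight (adj G) Z) ⟩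
    ∑ᵛ k (λ f → ∑ᵛ l (λ g → homWeight (adj G) Z (merge s f g)))
      ≡⟨ ∑ᵛ-cong k (λ f → ∑ᵛ-cong l λ g →
           ⟦⟧-× (hom? (adj G) (adj Z) (merge s f g)) (hom? Gˡ (adj Z) f) (hom? Gʳ (adj Z) g)
             (hom-merge⁻ (adj Z) f g) (hom-merge⁺ (adj Z) f g)) ⟩
    ∑ᵛ k (λ f → ∑ᵛ l (λ g → homWeight Gˡ Z f * homWeight Gʳ Z g))
      ≡⟨ ∑ᵛ-cong k (λ f → ∑ᵛ-* l (homWeight Gˡ Z f) (homWeight Gʳ Z)) ⟩
    ∑ᵛ k (λ f → homWeight Gˡ Z f * homCount Gʳ Z)
      ≡⟨ ∑ᵛ-*ʳ k (homCount Gʳ Z) (homWeight Gˡ Z) ⟩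
    homCount Gˡ Z * homCount Gʳ Z ∎

  homCount-reconstructible : k < m → l < m → m ≤ suc n → {X Y : Graph (suc n)} →
    SameDeckSums X Y → homCount (adj G) X ≡ homCount (adj G) Y
  homCount-reconstructible k<m l<m m≤1+n {X} {Y} same = begin
    homCount (adj G) X             ≡⟨ homCount-split X ⟩
    homCount Gˡ X * homCount Gʳ X  ≡⟨ cong₂ _*_ (small Gˡ k<m) (small Gʳ l<m) ⟩
    homCount Gˡ Y * homCount Gʳ Y  ≡⟨ homCount-split Y ⟨
    homCount (adj G) Y             ∎
    where
    small : ∀ {p} (B : Fin p → Fin p → Bool) → p < m → homCount B X ≡ homCount B Y
    small B p<m = kelly-small (homWeight B) (homWeight-natural B)
      (ℕ.≤-pred (ℕ.≤-trans p<m m≤1+n)) same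

-- Since adjacency is symmetric, `closed` makes `part` a union of connected components.
record Separation (X : Graph n) : Set where
  field
    part    : Subset n
    inside  : ∃ λ u → u ∈ part
    outside : ∃ λ v → v ∉ part
    closed  : ∀ {v w} → v ∈ part → Adjacent X v w → w ∈ part

-- As long as an edge vw leaves S, its endpoint w is added; w is reachable through v. This stops
-- because S grows strictly among the subsets of a finite set.
reachable-closure : (X : Graph n) (u : Fin n) (S : Subset n) → Acc _⊃_ S →
  u ∈ S → (∀ {v} → v ∈ S → Star (Adjacent X) u v) →
  Σ (Subset n) λ S → u ∈ S × (∀ {v} → v ∈ S → Star (Adjacent X) u v) ×
    (∀ {v w} → v ∈ S → Adjacent X v w → w ∈ S)
reachable-closure X u S (acc rs) u∈S reachable
  with any? (λ v → any? λ w → v ∈? S ×-dec T? (adj X v w) ×-dec ¬? (w ∈? S))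
... | no ∄ = S , u∈S , reachable , λ v∈S vw → decidable-stable (_ ∈? S) λ w∉S →
  ∄ (_ , _ , v∈S , vw , w∉S)
... | yes (v , w , v∈S , vw , w∉S) = reachable-closure X u (S ∪ ⁅ w ⁆)
  (rs (p⊆p∪q ⁅ w ⁆ , w , x∈p∪q⁺ (inj₂ (x∈⁅x⁆ w)) , w∉S))
  (p⊆p∪q ⁅ w ⁆ u∈S)
  λ {x} x∈ → case-∪ x (x∈p∪q⁻ S ⁅ w ⁆ x∈)
  where
  case-∪ : ∀ x → x ∈ S ⊎ x ∈ ⁅ w ⁆ → Star (Adjacent X) u x
  case-∪ x (inj₁ x∈S) = reachable x∈S
  case-∪ x (inj₂ x∈w) = subst (Star (Adjacent X) u) (sym (x∈⁅y⁆⇒x≡y w x∈w))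
    (reachable v∈S ◅◅ (vw ◅ ε))

-- The set of vertices reachable from `zero` is closed under adjacency. Either it misses a vertex
-- and separates X, or any two vertices are joined by a path through `zero`.
connected⊎separation : (X : Graph n) → Connected X ⊎ Separation X
connected⊎separation {zero}  X = inj₁ λ ()
connected⊎separation {suc n} X
  with reachable-closure X zero ⁅ zero ⁆ (⊃-wellFounded _) (x∈⁅x⁆ zero)
         (λ v∈ → subst (Star (Adjacent X) zero) (sym (x∈⁅y⁆⇒x≡y zero v∈)) ε)
... | S , u∈S , reachable , closed with any? (λ v → ¬? (v ∈? S))
...   | yes outside = inj₂ record
  { part = S ; inside = zero , u∈S ; outside = outside ; closed = closed }
...   | no ∄ = inj₁ λ v w → reverse (subst T (adj-sym X _ _)) (from-zero v) ◅◅ from-zero w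
  where
  from-zero : ∀ v → Star (Adjacent X) zero v
  from-zero v = reachable (decidable-stable (v ∈? S) λ v∉S → ∄ (v , v∉S))

inhabited : Fin n → 0 < n
inhabited {suc n} _ = s≤s z≤n

separation⇒homCount-reconstructible : {X Y : Graph (suc n)} → Separation X →
  SameDeckSums X Y → homCount (adj X) X ≡ homCount (adj X) Y
separation⇒homCount-reconstructible {X = X} sep same with split part
  where open Separation sep
... | k , l , s , inside-part , outside-part =
  homCount-reconstructible X s apart k<m l<m ℕ.≤-refl same
  where
  open Separation sep

  ∉part : ∀ j → inʳ s j ∉ part
  ∉part j j∈ with () ← trans (sym ([]=⇒lookup j∈)) (outside-part j)

  ∈part : ∀ i → inˡ s i ∈ part
  ∈part i = lookup⇒[]= _ part (inside-part i)

  apart : ∀ i j → ¬ Adjacent X (inˡ s i) (inʳ s j)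
  apart i j ij = ∉part j (closed (∈part i) ij)

  0<k : 0 < k
  0<k with side s (proj₁ inside)
  ... | inj₁ (i , _)  = inhabited i
  ... | inj₂ (j , eq) = contradiction (subst (_∈ part) (sym eq) (proj₂ inside)) (∉part j)

  0<l : 0 < l
  0<l with side s (proj₁ outside)
  ... | inj₁ (i , eq) = contradiction (subst (_∈ part) eq (∈part i)) (proj₂ outside)
  ... | inj₂ (j , _)  = inhabited j

  -- Both sides are nonempty, so each has fewer points than X, as Kelly's lemma requires.
  k<m : k < suc _
  k<m = subst (k <_) (sizes s) (ℕ.m<m+n k 0<l)

  l<m : l < suc _
  l<m = subst (l <_) (sizes s) (ℕ.m<n+m l 0<k)

missed-identity : missed (Vec.allFin n) ≡ 0
missed-identity {n} = trans (sum-cong-≗ {n} λ v → ⟦⟧-no (fresh? v (Vec.allFin n))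
  (λ fr → All.lookup⁺ fr v (sym (lookup-allFin v)))) (sum-replicate-zero n)

homCount⇒bijective-hom : {X Y : Graph (suc n)} → SameDeckSums X Y →
  homCount (adj X) X ≡ homCount (adj X) Y →
  Σ (Permutation′ (suc n)) λ π → ∀ i j → Adjacent X i j → Adjacent Y (π ⟨$⟩ʳ i) (π ⟨$⟩ʳ j)
homCount⇒bijective-hom {n} {X} {Y} same eq = bijection (∑ᵛ-witness (suc n) (onto Y) onto-Y≢0)
  where
  h : Weight (suc n)
  h = homWeight (adj X)

  onto nonOnto : ∀ Z → Vec (Fin (suc n)) (suc n) → ℕ
  onto    Z f = h Z f * ⟦ missed f ℕ.≟ 0 ⟧
  nonOnto Z f = h Z f * ⟦ 1 ℕ.≤? missed f ⟧

  partition : ∀ Z → homCount (adj X) Z ≡ ∑ᵛ (suc n) (onto Z) + ∑ᵛ (suc n) (nonOnto Z)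
  partition Z = trans (∑ᵛ-cong (suc n) λ f → go (missed f) (h Z f)) (∑ᵛ-+ (suc n) (onto Z) (nonOnto Z))
    where
    go : ∀ d a → a ≡ a * ⟦ d ℕ.≟ 0 ⟧ + a * ⟦ 1 ℕ.≤? d ⟧
    go zero    a = sym (trans (cong₂ _+_ (ℕ.*-identityʳ a) (ℕ.*-zeroʳ a)) (ℕ.+-identityʳ a))
    go (suc d) a = sym (trans (cong (_+ a * 1) (ℕ.*-zeroʳ a)) (ℕ.*-identityʳ a))

  onto-eq : ∑ᵛ (suc n) (onto X) ≡ ∑ᵛ (suc n) (onto Y)
  onto-eq = ℕ.+-cancelʳ-≡ (∑ᵛ (suc n) (nonOnto X)) (∑ᵛ (suc n) (onto X)) (∑ᵛ (suc n) (onto Y)) (begin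
    ∑ᵛ (suc n) (onto X) + ∑ᵛ (suc n) (nonOnto X)  ≡⟨ partition X ⟨
    homCount (adj X) X                            ≡⟨ eq ⟩
    homCount (adj X) Y                            ≡⟨ partition Y ⟩
    ∑ᵛ (suc n) (onto Y) + ∑ᵛ (suc n) (nonOnto Y)
      ≡⟨ cong (∑ᵛ (suc n) (onto Y) +_) (kelly h (homWeight-natural (adj X)) same) ⟨
    ∑ᵛ (suc n) (onto Y) + ∑ᵛ (suc n) (nonOnto X)  ∎)

  onto-identity : onto X (Vec.allFin (suc n)) ≡ 1
  onto-identity = cong₂ _*_
    (⟦⟧-yes (hom? (adj X) (adj X) (Vec.allFin (suc n))) (identity-hom X))
    (⟦⟧-yes (missed (Vec.allFin (suc n)) ℕ.≟ 0) (missed-identity {suc n}))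

  onto-Y≢0 : ∑ᵛ (suc n) (onto Y) ≢ 0
  -- The identity is a surjective homomorphism from X to X, so the common number is not 0.
  onto-Y≢0 = subst (_≢ 0) onto-eq
    (∑ᵛ-≢0 (onto X) (Vec.allFin (suc n)) (subst (_≢ 0) (sym onto-identity) λ ()))

  bijection : (∃ λ f → onto Y f ≢ 0) →
    Σ (Permutation′ (suc n)) λ π → ∀ i j → Adjacent X i j → Adjacent Y (π ⟨$⟩ʳ i) (π ⟨$⟩ʳ j)
  bijection (f , ≢0) =
    let π , π≗ = surjective⇒permutation (lookup f)
          (covers f (⟦⟧-witness (missed f ℕ.≟ 0) (*≢0ʳ (h Y f) ≢0)))
    in π , λ i j ij → subst T (sym (cong₂ (adj Y) (π≗ i) (π≗ j)))
         (⟦⟧-witness (hom? (adj X) (adj Y) f) (*≢0ˡ ≢0) i j ij)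

-- Complements

complement : Graph n → Graph n
complement X = record
  { adj        = λ i j → not (does (i ≟ j)) ∧ not (adj X i j)
  ; adj-sym    = λ i j → cong₂ (λ a b → not a ∧ not b)
      (does-⇔ (mk⇔ sym sym) (i ≟ j) (j ≟ i)) (adj-sym X i j)
  ; adj-irrefl = λ i → cong (λ a → not a ∧ not (adj X i i)) (≟-diag i)
  }
  where
  ≟-diag : (i : Fin n) → does (i ≟ i) ≡ true
  ≟-diag i with i ≟ i
  ... | yes _  = refl
  ... | no i≢i = contradiction refl i≢i

complement-≅ : {X Y : Graph n} → X ≅ Y → complement X ≅ complement Y
complement-≅ (π , iso) = π , λ i j → cong₂ (λ a b → not a ∧ not b)
  (does-⇔ (mk⇔ (cong (π ⟨$⟩ʳ_)) (permutation-injective π)) (i ≟ j) ((π ⟨$⟩ʳ i) ≟ (π ⟨$⟩ʳ j)))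
  (iso i j)

complement-involutive : (X : Graph n) → X ≅ complement (complement X)
complement-involutive X = idₚ , λ i j → pointwise i j
  where
  pointwise : ∀ i j → adj X i j ≡ adj (complement (complement X)) i j
  pointwise i j with i ≟ j
  ... | yes refl = adj-irrefl X i
  ... | no  _    = sym (not-involutive (adj X i j))

complement-− : (X : Graph (suc n)) (v : Fin (suc n)) → complement (X − v) ≅ complement X − v
complement-− X v = idₚ , λ i j → cong (λ a → not a ∧ not (adj X (punchIn v i) (punchIn v j)))
  (does-⇔ (mk⇔ (cong (punchIn v)) (punchIn-injective v i j)) (i ≟ j) (punchIn v i ≟ punchIn v j))

≅-of-complements : {X Y : Graph n} → complement X ≅ complement Y → X ≅ Y
≅-of-complements {n} {X} {Y} iso = ≅.trans {X} {complement (complement X)} {Y}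
  (complement-involutive X)
  (≅.trans {complement (complement X)} {complement (complement Y)} {Y}
    (complement-≅ {X = complement X} {complement Y} iso)
    (≅.sym {Y} {complement (complement Y)} (complement-involutive Y)))
  where module ≅ = Setoid (graphSetoid n)

-- Complementation commutes with the deletion of a vertex up to isomorphism, so a sum of F over the
-- new family is a sum of the invariant `F ∘ complement` over the old one.
complement-same : {X Y : Graph (suc n)} → SameDeckSums X Y →
  SameDeckSums (complement X) (complement Y)
complement-same {n} {X} {Y} same .deck-sum F F-≅ = begin
  ∑[ v < suc n ] F (complement X − v)
    ≡⟨ sum-cong-≗ (λ v → F-≅ (complement (X − v)) (complement X − v) (complement-− X v)) ⟨
  ∑[ v < suc n ] F (complement (X − v))
    ≡⟨ deck-sum same (F ∘ complement)
         (λ Z Z′ iso → F-≅ (complement Z) (complement Z′) (complement-≅ {X = Z} {Z′} iso)) ⟩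
  ∑[ v < suc n ] F (complement (Y − v))
    ≡⟨ sum-cong-≗ (λ v → F-≅ (complement (Y − v)) (complement Y − v) (complement-− Y v)) ⟩
  ∑[ v < suc n ] F (complement Y − v)    ∎

-- Edge counts of a graph and its complement

∑ᴸ-pairs : (φ : Fin n × Fin n → ℕ) →
  ∑ᴸ (pairs n) φ ≡ ∑[ i < n ] ∑[ j < n ] (⟦ i <? j ⟧ * φ (i , j))
∑ᴸ-pairs {n} φ = begin
  ∑ᴸ (pairs n) φ
    ≡⟨ ∑ᴸ-filter (λ (i , j) → i <? j) (List.cartesianProduct (List.allFin n) (List.allFin n)) φ ⟩
  ∑ᴸ (List.cartesianProduct (List.allFin n) (List.allFin n)) (λ (i , j) → ⟦ i <? j ⟧ * φ (i , j))
    ≡⟨ ∑ᴸ-cartesianProduct (List.allFin n) (List.allFin n) _ ⟩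
  ∑ᴸ (List.allFin n) (λ i → ∑ᴸ (List.allFin n) (λ j → ⟦ i <? j ⟧ * φ (i , j)))
    ≡⟨ ∑ᴸ-tabulate {n} id _ ⟩
  ∑[ i < n ] ∑ᴸ (List.allFin n) (λ j → ⟦ i <? j ⟧ * φ (i , j))
    ≡⟨ sum-cong-≗ {n} (λ i → ∑ᴸ-tabulate {n} id (λ j → ⟦ i <? j ⟧ * φ (i , j))) ⟩
  ∑[ i < n ] ∑[ j < n ] (⟦ i <? j ⟧ * φ (i , j)) ∎

sum-ones : ∀ n → ∑[ i < n ] 1 ≡ n
sum-ones zero    = refl
sum-ones (suc n) = cong suc (sum-ones n)

-- Pascal's rule: among n + 1 elements, `n C 1` pairs contain the least element and `n C 2` do not.
sum-<≡nC2 : ∀ n → ∑[ i < n ] ∑[ j < n ] ⟦ i <? j ⟧ ≡ n C 2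
sum-<≡nC2 zero    = refl
sum-<≡nC2 (suc n) = begin
  ∑[ j < n ] ⟦ zero {n} <? suc j ⟧ + ∑[ i < n ] ∑[ j < n ] ⟦ suc i <? suc j ⟧
    ≡⟨ cong₂ _+_ (sum-cong-≗ {n} (λ j → ⟦⟧-yes (zero {n} <? suc j) (s≤s z≤n)))
         (sum-cong-≗ {n} λ i → sum-cong-≗ {n} λ j →
            ⟦⟧-cong (suc i <? suc j) (i <? j) s≤s⁻¹ s≤s) ⟩
  ∑[ j < n ] 1 + ∑[ i < n ] ∑[ j < n ] ⟦ i <? j ⟧
    ≡⟨ cong₂ _+_ (trans (sum-ones n) (sym (nC1≡n n))) (sum-<≡nC2 n) ⟩
  n C 1 + n C 2
    ≡⟨ nCk+nC[k+1]≡[n+1]C[k+1] n 1 ⟩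
  suc n C 2 ∎

edgeCount-complement : (X : Graph n) → edgeCount X + edgeCount (complement X) ≡ n C 2
edgeCount-complement {n} X = begin
  ∑ᴸ (pairs n) (entry X) + ∑ᴸ (pairs n) (entry (complement X))
    ≡⟨ ∑ᴸ-+ (pairs n) (entry X) (entry (complement X)) ⟨
  ∑ᴸ (pairs n) (λ p → entry X p + entry (complement X) p)
    ≡⟨ ∑ᴸ-pairs {n} (λ p → entry X p + entry (complement X) p) ⟩
  ∑[ i < n ] ∑[ j < n ] (⟦ i <? j ⟧ * (entry X (i , j) + entry (complement X) (i , j)))
    ≡⟨ sum-cong-≗ {n} (λ i → sum-cong-≗ {n} λ j → trans
         (⟦⟧*-cong (i <? j) (λ i<j → one i j (Fin.<⇒≢ i<j))) (ℕ.*-identityʳ ⟦ i <? j ⟧)) ⟩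
  ∑[ i < n ] ∑[ j < n ] ⟦ i <? j ⟧
    ≡⟨ sum-<≡nC2 n ⟩
  n C 2 ∎
  where
  one : ∀ i j → i ≢ j → entry X (i , j) + entry (complement X) (i , j) ≡ 1
  one i j i≢j with i ≟ j | adj X i j
  ... | yes eq | _     = contradiction eq i≢j
  ... | no _   | true  = refl
  ... | no _   | false = refl

-- The two edge counts add up to `n C 2`, and twice the smaller of two numbers is at most their sum.
few-edges : (X : Graph n) →
  edgeCount X ≤ ⌊ n C 2 /2⌋ ⊎ edgeCount (complement X) ≤ ⌊ n C 2 /2⌋
few-edges {n} X = halve (n C 2) (edgeCount X) _ (edgeCount-complement X)
  where
  halve : ∀ t a b → a + b ≡ t → a ≤ ⌊ t /2⌋ ⊎ b ≤ ⌊ t /2⌋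
  halve t a b refl with ℕ.≤-total a b
  ... | inj₁ a≤b = inj₁ (subst (_≤ ⌊ a + b /2⌋) (sym (ℕ.n≡⌊n+n/2⌋ a)) (ℕ.⌊n/2⌋-mono (ℕ.+-monoʳ-≤ a a≤b)))
  ... | inj₂ b≤a = inj₂ (subst (_≤ ⌊ a + b /2⌋) (sym (ℕ.n≡⌊n+n/2⌋ b)) (ℕ.⌊n/2⌋-mono (ℕ.+-monoˡ-≤ b b≤a)))

-- Induction on the derivation of the list permutation; the invariance of F absorbs the isomorphisms
-- it contains.
sameVertexDeleted⇒sameDeckSums : {X Y : Graph (suc n)} → SameVertexDeleted X Y → SameDeckSums X Y
sameVertexDeleted⇒sameDeckSums {n} {X} {Y} same .deck-sum F F-≅ =
  trans (sym (deck X)) (trans (∑ᴸ-↭ same) (deck Y))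
  where
  deck : ∀ Z → ∑ᴸ (vertexDeleted Z) F ≡ ∑[ v < suc n ] F (Z − v)
  deck Z = trans (∑ᴸ-map (Z −_) (List.allFin (suc n)) F) (∑ᴸ-tabulate {suc n} id (λ v → F (Z − v)))

  ∑ᴸ-↭ : ∀ {xs ys} → Permutation.Permutation _≅_ xs ys → ∑ᴸ xs F ≡ ∑ᴸ ys F
  ∑ᴸ-↭ (Permutation.refl [])         = refl
  ∑ᴸ-↭ (Permutation.refl (e ∷ es))   = cong₂ _+_ (F-≅ _ _ e) (∑ᴸ-↭ (Permutation.refl es))
  ∑ᴸ-↭ (Permutation.prep e p)        = cong₂ _+_ (F-≅ _ _ e) (∑ᴸ-↭ p)
  ∑ᴸ-↭ (Permutation.swap {x = x} {y} e₁ e₂ p) = trans (x+[y+z]≡y+[x+z] (F x) (F y) _)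
    (cong₂ _+_ (F-≅ _ _ e₂) (cong₂ _+_ (F-≅ _ _ e₁) (∑ᴸ-↭ p)))
  ∑ᴸ-↭ (Permutation.trans p q)       = trans (∑ᴸ-↭ p) (∑ᴸ-↭ q)

-- Injective words

unique? : (f : Vec (Fin n) m) → Dec (Unique f)
unique? = AllPairs.allPairs? (λ i j → ¬? (i ≟ j))

-- The sum over the injective maps from `Fin m` to `Fin n`; for m = n it runs over all permutations
-- of `Fin m`.
injSum : ∀ m → (Vec (Fin n) m → ℕ) → ℕ
injSum m φ = ∑ᵛ m (λ f → ⟦ unique? f ⟧ * φ f)

injSum-cong : ∀ m {φ ψ : Vec (Fin n) m → ℕ} → φ ≗ ψ → injSum m φ ≡ injSum m ψ
injSum-cong m eq = ∑ᵛ-cong m λ f → cong (⟦ unique? f ⟧ *_) (eq f)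

injSum-∷ : ∀ m (ψ : Vec (Fin n) (suc m) → ℕ) →
  injSum (suc m) ψ ≡ ∑[ i < n ] injSum m (λ f → ⟦ fresh? i f ⟧ * ψ (i ∷ f))
injSum-∷ m ψ = sum-cong-≗ λ i → ∑ᵛ-cong m λ f → begin
  ⟦ unique? (i ∷ f) ⟧ * ψ (i ∷ f)
    ≡⟨ cong (_* ψ (i ∷ f)) (⟦⟧-× (unique? (i ∷ f)) (unique? f) (fresh? i f)
         (λ { (p ∷ ps) → ps , p }) (λ (ps , p) → p ∷ ps)) ⟩
  ⟦ unique? f ⟧ * ⟦ fresh? i f ⟧ * ψ (i ∷ f)
    ≡⟨ ℕ.*-assoc ⟦ unique? f ⟧ _ _ ⟩
  ⟦ unique? f ⟧ * (⟦ fresh? i f ⟧ * ψ (i ∷ f)) ∎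

unique-map⁻ : (ρ : A → B) (f : Vec A m) → Unique (Vec.map ρ f) → Unique f
unique-map⁻ ρ []      []       = []
unique-map⁻ ρ (_ ∷ f) (p ∷ ps) = All.map (_∘ cong ρ) (All.map⁻ p) ∷ unique-map⁻ ρ f ps

unique-map : {ρ : Fin k → Fin l} → Injective ρ → (f : Vec (Fin k) m) →
  ⟦ unique? (Vec.map ρ f) ⟧ ≡ ⟦ unique? f ⟧
unique-map {ρ = ρ} inj f = ⟦⟧-cong (unique? (Vec.map ρ f)) (unique? f) (unique-map⁻ ρ f) (map⁺ inj)

injSum-punchIn : ∀ m (v : Fin (suc n)) (φ : Vec (Fin (suc n)) m → ℕ) →
  injSum m (φ ∘ Vec.map (punchIn v)) ≡ injSum m (λ f → ⟦ fresh? v f ⟧ * φ f)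
injSum-punchIn m v φ = begin
  ∑ᵛ m (λ f → ⟦ unique? f ⟧ * φ (Vec.map (punchIn v) f))
    ≡⟨ ∑ᵛ-cong m (λ f → cong (_* φ (Vec.map (punchIn v) f))
         (sym (unique-map (punchIn-injective v _ _) f))) ⟩
  ∑ᵛ m (λ f → ⟦ unique? (Vec.map (punchIn v) f) ⟧ * φ (Vec.map (punchIn v) f))
    ≡⟨ ∑ᵛ-punchIn m v (λ f → ⟦ unique? f ⟧ * φ f) ⟩
  ∑ᵛ m (λ f → ⟦ fresh? v f ⟧ * (⟦ unique? f ⟧ * φ f))
    ≡⟨ ∑ᵛ-cong m (λ f → x*[y*z]≡y*[x*z] ⟦ fresh? v f ⟧ ⟦ unique? f ⟧ (φ f)) ⟩
  ∑ᵛ m (λ f → ⟦ unique? f ⟧ * (⟦ fresh? v f ⟧ * φ f)) ∎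

fresh-insertAt : ∀ {w v : Fin n} → w ≢ v → (f : Vec (Fin n) m) (p : Fin (suc m)) →
  ⟦ fresh? w (insertAt f p v) ⟧ ≡ ⟦ fresh? w f ⟧
fresh-insertAt {n} {w = w} {v} w≢v f p =
  ⟦⟧-cong (fresh? w (insertAt f p v)) (fresh? w f) (from f p) (to f p)
  where
  to : ∀ {m} (f : Vec (Fin n) m) p → Fresh w f → Fresh w (insertAt f p v)
  to f       zero    ps       = w≢v ∷ ps
  to (_ ∷ f) (suc p) (q ∷ ps) = q ∷ to f p ps

  from : ∀ {m} (f : Vec (Fin n) m) p → Fresh w (insertAt f p v) → Fresh w f
  from f       zero    (_ ∷ ps) = ps
  from (_ ∷ f) (suc p) (q ∷ ps) = q ∷ from f p ps

-- An injective word either avoids v or contains it at a unique position p.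
injSum-remove : ∀ m (v : Fin (suc n)) (ψ : Vec (Fin (suc n)) (suc m) → ℕ) →
  injSum (suc m) ψ ≡
    injSum (suc m) (ψ ∘ Vec.map (punchIn v))
    + ∑[ p < suc m ] injSum m (λ f → ψ (insertAt (Vec.map (punchIn v) f) p v))
injSum-remove {n} m v ψ = begin
  injSum (suc m) ψ
    ≡⟨ injSum-∷ m ψ ⟩
  ∑[ i < suc n ] injSum m (λ f → ⟦ fresh? i f ⟧ * ψ (i ∷ f))
    ≡⟨ sum-remove {i = v} (λ i → injSum m (λ f → ⟦ fresh? i f ⟧ * ψ (i ∷ f))) ⟩
  injSum m (λ f → ⟦ fresh? v f ⟧ * ψ (v ∷ f))
    + ∑[ i < n ] injSum m (λ f → ⟦ fresh? (punchIn v i) f ⟧ * ψ (punchIn v i ∷ f))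
    ≡⟨ cong₂ _+_ (sym (injSum-punchIn m v (ψ ∘ (v ∷_)))) (rest m ψ) ⟩
  injSum m (λ f → ψ (v ∷ Vec.map (punchIn v) f))
    + (injSum (suc m) (ψ ∘ Vec.map (punchIn v)) + tail m ψ)
    ≡⟨ x+[y+z]≡y+[x+z] (injSum m (λ f → ψ (v ∷ Vec.map (punchIn v) f)))
         (injSum (suc m) (ψ ∘ Vec.map (punchIn v))) (tail m ψ) ⟩
  injSum (suc m) (ψ ∘ Vec.map (punchIn v))
    + (injSum m (λ f → ψ (v ∷ Vec.map (punchIn v) f)) + tail m ψ) ∎
  where
  tail : ∀ m → (Vec (Fin (suc n)) (suc m) → ℕ) → ℕ
  tail m ψ = ∑[ p < m ] injSum m (λ f → ψ (insertAt (Vec.map (punchIn v) f) (suc p) v))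

  rest : ∀ m (ψ : Vec (Fin (suc n)) (suc m) → ℕ) →
    ∑[ i < n ] injSum m (λ f → ⟦ fresh? (punchIn v i) f ⟧ * ψ (punchIn v i ∷ f))
      ≡ injSum (suc m) (ψ ∘ Vec.map (punchIn v)) + tail m ψ
  rest zero    ψ = sym (trans (ℕ.+-identityʳ _) (injSum-∷ 0 (ψ ∘ Vec.map (punchIn v))))
  rest (suc m) ψ = begin
    ∑[ i < n ] injSum (suc m) (step i)
      -- The first letter is not v, so the alternative passes to the rest of the word, which is
      -- shorter.
      ≡⟨ sum-cong-≗ (λ i → injSum-remove m v (step i)) ⟩
    ∑[ i < n ] (injSum (suc m) (step i ∘ Vec.map (punchIn v))
      + ∑[ p < suc m ] injSum m (λ f → step i (insertAt (Vec.map (punchIn v) f) p v)))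
      ≡⟨ ∑-distrib-+ (λ i → injSum (suc m) (step i ∘ Vec.map (punchIn v))) _ ⟩
    ∑[ i < n ] injSum (suc m) (step i ∘ Vec.map (punchIn v))
      + ∑[ i < n ] ∑[ p < suc m ] injSum m (λ f → step i (insertAt (Vec.map (punchIn v) f) p v))
      ≡⟨ cong₂ _+_ avoiding containing ⟩
    injSum (suc (suc m)) (ψ ∘ Vec.map (punchIn v)) + tail (suc m) ψ ∎
    where
    step : Fin n → Vec (Fin (suc n)) (suc m) → ℕ
    step i f = ⟦ fresh? (punchIn v i) f ⟧ * ψ (punchIn v i ∷ f)

    avoiding : ∑[ i < n ] injSum (suc m) (step i ∘ Vec.map (punchIn v))
      ≡ injSum (suc (suc m)) (ψ ∘ Vec.map (punchIn v))
    avoiding = trans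
      (sum-cong-≗ λ i → injSum-cong (suc m) λ f →
        cong (_* ψ (punchIn v i ∷ Vec.map (punchIn v) f)) (fresh-map (punchIn-injective v _ _) i f))
      (sym (injSum-∷ (suc m) (ψ ∘ Vec.map (punchIn v))))

    containing : ∑[ i < n ] ∑[ p < suc m ] injSum m (λ f → step i (insertAt (Vec.map (punchIn v) f) p v))
      ≡ tail (suc m) ψ
    containing = trans
      (∑-comm {n} {suc m} (λ i p → injSum m (λ f → step i (insertAt (Vec.map (punchIn v) f) p v))))
      (sum-cong-≗ λ p → trans
        (sum-cong-≗ λ i → injSum-cong m λ f →
          cong (_* ψ (punchIn v i ∷ insertAt (Vec.map (punchIn v) f) p v)) (trans
            (fresh-insertAt (punchInᵢ≢i v i) (Vec.map (punchIn v) f) p)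
            (fresh-map (punchIn-injective v _ _) i f)))
        (sym (injSum-∷ m (λ f → ψ (insertAt (Vec.map (punchIn v) f) (suc p) v)))))

injSum-vanish : n < m → (φ : Vec (Fin n) m → ℕ) → injSum m φ ≡ 0
injSum-vanish {m = m} n<m φ = trans
  (∑ᵛ-cong m λ f → cong (_* φ f) (⟦⟧-no (unique? f) λ u →
    let i , j , i<j , eq = pigeonhole n<m (lookup f)
    in contradiction (lookup-injective u i j eq) (Fin.<⇒≢ i<j)))
  (∑ᵛ-zero m)

toℕ-punchIn-last : ∀ N (i : Fin N) → toℕ (punchIn (fromℕ N) i) ≡ toℕ i
toℕ-punchIn-last (suc N) zero    = refl
toℕ-punchIn-last (suc N) (suc i) = cong suc (toℕ-punchIn-last N i)

lookup-∷ʳ-punchIn : (r : Vec A m) (x : A) (i : Fin m) →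
  lookup (r Vec.∷ʳ x) (punchIn (fromℕ m) i) ≡ lookup r i
lookup-∷ʳ-punchIn (_ ∷ r) x zero    = refl
lookup-∷ʳ-punchIn (_ ∷ r) x (suc i) = lookup-∷ʳ-punchIn r x i

lookup-∷ʳ-last : (r : Vec A m) (x : A) → lookup (r Vec.∷ʳ x) (fromℕ m) ≡ x
lookup-∷ʳ-last []      x = refl
lookup-∷ʳ-last (_ ∷ r) x = lookup-∷ʳ-last r x

-- An injective word is a rearrangement of its sorted version.
injSum-increasing : ∀ m N (φ : Vec ℕ m → ℕ) →
  injSum {N} m (φ ∘ Vec.map toℕ)
    ≡ ∑ᴸ (increasing m N) (λ r → injSum {m} m (λ g → φ (Vec.map (lookup r) g)))
injSum-increasing zero    N       φ = sym (ℕ.+-identityʳ _)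
injSum-increasing (suc m) zero    φ = refl
injSum-increasing (suc m) (suc N) φ = begin
  injSum (suc m) (φ ∘ Vec.map toℕ)
    -- Split by the largest letter `fromℕ N`: it is absent, or it stands at one position p and
    -- becomes the last entry of the sorted word.
    ≡⟨ injSum-remove m (fromℕ N) (φ ∘ Vec.map toℕ) ⟩
  injSum (suc m) (λ f → φ (Vec.map toℕ (Vec.map (punchIn (fromℕ N)) f)))
    + ∑[ p < suc m ] injSum m (λ f → φ (Vec.map toℕ (insertAt (Vec.map (punchIn (fromℕ N)) f) p (fromℕ N))))
    ≡⟨ cong₂ _+_
         (injSum-cong (suc m) λ f → cong φ (small f))
         (sum-cong-≗ {suc m} λ p → injSum-cong m λ f → cong φ (inserted f p)) ⟩
  injSum {N} (suc m) (φ ∘ Vec.map toℕ)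
    + ∑[ p < suc m ] injSum {N} m (λ f → φ (insertAt (Vec.map toℕ f) p N))
    ≡⟨ cong₂ _+_ (injSum-increasing (suc m) N φ)
         (sum-cong-≗ {suc m} λ p → injSum-increasing m N (λ w → φ (insertAt w p N))) ⟩
  ∑ᴸ (increasing (suc m) N) total
    + ∑[ p < suc m ] ∑ᴸ (increasing m N) (λ r → injSum m (λ g → φ (insertAt (Vec.map (lookup r) g) p N)))
    ≡⟨ cong (∑ᴸ (increasing (suc m) N) total +_) (∑-∑ᴸ {k = suc m} (increasing m N)
         λ p r → injSum m (λ g → φ (insertAt (Vec.map (lookup r) g) p N))) ⟩
  ∑ᴸ (increasing (suc m) N) total
    + ∑ᴸ (increasing m N) (λ r → ∑[ p < suc m ] injSum m (λ g → φ (insertAt (Vec.map (lookup r) g) p N)))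
    ≡⟨ cong (∑ᴸ (increasing (suc m) N) total +_) (∑ᴸ-cong (increasing m N) total-∷ʳ) ⟨
  ∑ᴸ (increasing (suc m) N) total + ∑ᴸ (increasing m N) (total ∘ (Vec._∷ʳ N))
    ≡⟨ cong (∑ᴸ (increasing (suc m) N) total +_) (∑ᴸ-map (Vec._∷ʳ N) (increasing m N) total) ⟨
  ∑ᴸ (increasing (suc m) N) total + ∑ᴸ (List.map (Vec._∷ʳ N) (increasing m N)) total
    ≡⟨ ∑ᴸ-++ (increasing (suc m) N) _ total ⟨
  ∑ᴸ (increasing (suc m) (suc N)) total ∎
  where
  total : Vec ℕ (suc m) → ℕ
  total r = injSum {suc m} (suc m) (λ g → φ (Vec.map (lookup r) g))

  small : ∀ {k} (f : Vec (Fin N) k) → Vec.map toℕ (Vec.map (punchIn (fromℕ N)) f) ≡ Vec.map toℕ f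
  small f = trans (sym (map-∘ toℕ (punchIn (fromℕ N)) f)) (map-cong (toℕ-punchIn-last N) f)

  inserted : ∀ (f : Vec (Fin N) m) p →
    Vec.map toℕ (insertAt (Vec.map (punchIn (fromℕ N)) f) p (fromℕ N)) ≡ insertAt (Vec.map toℕ f) p N
  inserted f p = trans (map-insertAt toℕ (fromℕ N) (Vec.map (punchIn (fromℕ N)) f) p)
    (cong₂ (λ w x → insertAt w p x) (small f) (Fin.toℕ-fromℕ N))

  sorted : ∀ r (g : Vec (Fin m) m) p →
    Vec.map (lookup (r Vec.∷ʳ N)) (insertAt (Vec.map (punchIn (fromℕ m)) g) p (fromℕ m))
      ≡ insertAt (Vec.map (lookup r) g) p N
  sorted r g p = trans (map-insertAt _ (fromℕ m) (Vec.map (punchIn (fromℕ m)) g) p)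
    (cong₂ (λ w x → insertAt w p x)
      (trans (sym (map-∘ _ (punchIn (fromℕ m)) g)) (map-cong (lookup-∷ʳ-punchIn r N) g))
      (lookup-∷ʳ-last r N))

  total-∷ʳ : ∀ r → total (r Vec.∷ʳ N)
    ≡ ∑[ p < suc m ] injSum {m} m (λ g → φ (insertAt (Vec.map (lookup r) g) p N))
  total-∷ʳ r = trans
    (injSum-remove m (fromℕ m) (λ g → φ (Vec.map (lookup (r Vec.∷ʳ N)) g)))
    -- A word of m + 1 distinct letters over m + 1 letters contains the largest one, so only the
    -- positions p contribute.
    (cong₂ _+_ (injSum-vanish (ℕ.n<1+n m)
        (λ g → φ (Vec.map (lookup (r Vec.∷ʳ N)) (Vec.map (punchIn (fromℕ m)) g))))
      (sum-cong-≗ {suc m} λ p → injSum-cong m λ g → cong φ (sorted r g p)))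

-- Values of the polynomials 𝒫

-- `act` sorts the image pair; by symmetry of adjacency this does not change the entry.
entry-act : (G : Graph m) (σ : Permutation′ m) (i j : Fin m) →
  entry G (act σ (i , j)) ≡ ⟦ T? (adj G (σ ⟨$⟩ʳ i) (σ ⟨$⟩ʳ j)) ⟧
entry-act G σ i j with does ((σ ⟨$⟩ʳ i) <? (σ ⟨$⟩ʳ j))
... | true  = refl
... | false = cong (if_then 1 else 0) (adj-sym G (σ ⟨$⟩ʳ j) (σ ⟨$⟩ʳ i))

relabel : Graph m → Permutation′ m → Fin m → Fin m → Bool
relabel G σ i j = adj G (σ ⟨$⟩ʳ i) (σ ⟨$⟩ʳ j)

<⇒∈-pairs : {i j : Fin m} → i Fin.< j → (i , j) ∈ᴸ pairs m
<⇒∈-pairs {i = i} {j} i<j =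
  ∈-filter⁺ (λ (i , j) → i <? j) (∈-cartesianProduct⁺ (∈-allFin i) (∈-allFin j)) i<j

map-≡⁻ : {f g : A → B} (xs : List A) → List.map f xs ≡ List.map g xs →
  ∀ {x} → x ∈ᴸ xs → f x ≡ g x
map-≡⁻ (_ ∷ _)  eq (here refl) = ∷-injectiveˡ eq
map-≡⁻ (_ ∷ xs) eq (there x∈)  = map-≡⁻ xs (∷-injectiveʳ eq) x∈

-- A family records only the pairs with i < j; symmetry and the absence of loops determine the rest.
family≡⇒relabel≡ : (G : Graph m) (σ τ : Permutation′ m) → family G σ ≡ family G τ →
  ∀ i j → relabel G σ i j ≡ relabel G τ i j
family≡⇒relabel≡ {m} G σ τ eq = full
  where
  upper : ∀ {i j} → i Fin.< j → relabel G σ i j ≡ relabel G τ i j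
  upper {i} {j} i<j = ⟦T⟧-injective (trans (sym (entry-act G σ i j))
    (trans (map-≡⁻ (pairs m) eq (<⇒∈-pairs i<j)) (entry-act G τ i j)))

  full : ∀ i j → relabel G σ i j ≡ relabel G τ i j
  full i j with Fin.<-cmp i j
  ... | tri< i<j _ _  = upper i<j
  ... | tri≈ _ refl _ = trans (adj-irrefl G _) (sym (adj-irrefl G _))
  ... | tri> _ _ j<i  = trans (adj-sym G _ _) (trans (upper j<i) (adj-sym G _ _))

relabel≡⇒family≡ : (G : Graph m) (σ τ : Permutation′ m) →
  (∀ i j → relabel G σ i j ≡ relabel G τ i j) → family G σ ≡ family G τ
relabel≡⇒family≡ {m} G σ τ eq = List.map-cong
  (λ (i , j) → trans (entry-act G σ i j)
    (trans (cong (λ b → ⟦ T? b ⟧) (eq i j)) (sym (entry-act G τ i j))))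
  (pairs m)

-- Automorphisms and representatives of relabellings

Automorphic : (H : Graph m) → Vec (Fin m) m → Set
Automorphic H f = ∀ i j → adj H i j ≡ adj H (lookup f i) (lookup f j)

automorphic? : (H : Graph m) (f : Vec (Fin m) m) → Dec (Automorphic H f)
automorphic? H f = all? λ i → all? λ j → adj H i j Bool.≟ adj H (lookup f i) (lookup f j)

-- The order of the automorphism group of H.
automorphisms : Graph m → ℕ
automorphisms {m} H = injSum {m} m (λ f → ⟦ automorphic? H f ⟧)

unique-allFin : Unique (Vec.allFin n)
unique-allFin = tabulate⁺ id

automorphisms≢0 : (H : Graph m) → automorphisms H ≢ 0
automorphisms≢0 {m} H = ∑ᵛ-≢0 (λ f → ⟦ unique? f ⟧ * ⟦ automorphic? H f ⟧) (Vec.allFin m)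
  (subst (_≢ 0) (sym (cong₂ _*_ (⟦⟧-yes (unique? (Vec.allFin m)) unique-allFin)
    (⟦⟧-yes (automorphic? H (Vec.allFin m)) λ i j →
      sym (cong₂ (adj H) (lookup-allFin i) (lookup-allFin j))))) λ ())

unique⇒permutation : (f : Vec (Fin n) n) → Unique f →
  Σ (Permutation′ n) λ π → ∀ i → π ⟨$⟩ʳ i ≡ lookup f i
unique⇒permutation f u = injective⇒permutation (lookup f) (lookup-injective u _ _)

module _ (H : Graph m) where

  private
    _▹_ : Permutation′ m → Vec (Fin m) m → Vec (Fin m) m
    τ ▹ g = Vec.map (τ ⟨$⟩ʳ_) g

  -- For the permutation π given by g, the composite of τ after π is an automorphism exactly when τ
  -- and the inverse of π have the same family. Exactly one representative has that family.
  representatives-unique : (g : Vec (Fin m) m) → Unique g →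
    ∑ᴸ (representatives H) (λ τ → ⟦ automorphic? H (τ ▹ g) ⟧) ≡ 1
  representatives-unique g u = ∑ᴸ-unique (λ τ → automorphic? H (τ ▹ g))
    (Any.map (λ {τ} → exhaust {τ}) (representatives-exhaust H (inverse π)))
    (AllPairsᴸ.map (λ {τ} {τ′} → distinct {τ} {τ′}) (representatives-distinct H))
    where
    π : Permutation′ m
    π = proj₁ (unique⇒permutation g u)

    π≗ : ∀ i → π ⟨$⟩ʳ i ≡ lookup g i
    π≗ = proj₂ (unique⇒permutation g u)

    ▹-adj : ∀ τ i j → adj H (lookup (τ ▹ g) i) (lookup (τ ▹ g) j)
      ≡ relabel H τ (π ⟨$⟩ʳ i) (π ⟨$⟩ʳ j)
    ▹-adj τ i j = cong₂ (adj H) (entrywise i) (entrywise j)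
      where
      entrywise : ∀ i → lookup (τ ▹ g) i ≡ τ ⟨$⟩ʳ (π ⟨$⟩ʳ i)
      entrywise i = trans (lookup-map i (τ ⟨$⟩ʳ_) g) (cong (τ ⟨$⟩ʳ_) (sym (π≗ i)))

    exhaust : ∀ {τ} → family H (inverse π) ≡ family H τ → Automorphic H (τ ▹ g)
    exhaust {τ} eq i j = begin
      adj H i j
        ≡⟨ cong₂ (adj H) (inverseˡ π) (inverseˡ π) ⟨
      relabel H (inverse π) (π ⟨$⟩ʳ i) (π ⟨$⟩ʳ j)
        ≡⟨ family≡⇒relabel≡ H (inverse π) τ eq _ _ ⟩
      relabel H τ (π ⟨$⟩ʳ i) (π ⟨$⟩ʳ j)
        ≡⟨ ▹-adj τ i j ⟨
      adj H (lookup (τ ▹ g) i) (lookup (τ ▹ g) j) ∎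

    distinct : ∀ {τ τ′} → family H τ ≢ family H τ′ →
      Automorphic H (τ ▹ g) → ¬ Automorphic H (τ′ ▹ g)
    distinct {τ} {τ′} ≢ aut aut′ = ≢ (relabel≡⇒family≡ H τ τ′ λ i j → begin
      relabel H τ i j                                          ≡⟨ pulled τ aut i j ⟨
      adj H (π ⟨$⟩ˡ i) (π ⟨$⟩ˡ j)                              ≡⟨ pulled τ′ aut′ i j ⟩
      relabel H τ′ i j                                         ∎)
      where
      pulled : ∀ τ → Automorphic H (τ ▹ g) → ∀ i j →
        adj H (π ⟨$⟩ˡ i) (π ⟨$⟩ˡ j) ≡ relabel H τ i j
      pulled τ aut i j = trans (aut _ _) (trans (▹-adj τ _ _)
        (cong₂ (relabel H τ) (inverseʳ π) (inverseʳ π)))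

  -- The condition on `τ ▹ g` says that g is an isomorphism from H to `relabel H τ`, so composing r
  -- with g carries homomorphisms of the latter to homomorphisms of H.
  automorphic⇒hom⇔ : (A : W → W → Bool) (r : Vec W m) (g : Vec (Fin m) m) → Unique g →
    ∀ τ → Automorphic H (τ ▹ g) →
    ⟦ hom? (adj H) A (Vec.map (lookup r) g) ⟧ ≡ ⟦ hom? (relabel H τ) A r ⟧
  automorphic⇒hom⇔ A r g u τ aut =
    ⟦⟧-cong (hom? (adj H) A (Vec.map (lookup r) g)) (hom? (relabel H τ) A r)
      (λ h i j b → subst T (cong₂ A (at-g⁻¹ i) (at-g⁻¹ j))
        (h (g⁻¹ i) (g⁻¹ j) (subst T (sym (trans (aut _ _)
          (cong₂ (adj H) (τ-g⁻¹ i) (τ-g⁻¹ j)))) b)))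
      (λ h i j b → subst T (sym (cong₂ A (lookup-map i (lookup r) g) (lookup-map j (lookup r) g)))
        (h _ _ (subst T (trans (aut i j)
          (cong₂ (adj H) (lookup-map i (τ ⟨$⟩ʳ_) g) (lookup-map j (τ ⟨$⟩ʳ_) g))) b)))
    where
    π : Permutation′ m
    π = proj₁ (unique⇒permutation g u)

    g⁻¹ : Fin m → Fin m
    g⁻¹ i = π ⟨$⟩ˡ i

    g-g⁻¹ : ∀ i → lookup g (g⁻¹ i) ≡ i
    g-g⁻¹ i = trans (sym (proj₂ (unique⇒permutation g u) (g⁻¹ i))) (inverseʳ π)

    at-g⁻¹ : ∀ i → lookup (Vec.map (lookup r) g) (g⁻¹ i) ≡ lookup r i
    at-g⁻¹ i = trans (lookup-map (g⁻¹ i) (lookup r) g) (cong (lookup r) (g-g⁻¹ i))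

    τ-g⁻¹ : ∀ i → lookup (τ ▹ g) (g⁻¹ i) ≡ τ ⟨$⟩ʳ i
    τ-g⁻¹ i = trans (lookup-map (g⁻¹ i) (τ ⟨$⟩ʳ_) g) (cong (τ ⟨$⟩ʳ_) (g-g⁻¹ i))

  -- A coset decomposition: every permutation g yields exactly one representative τ for which
  -- `τ ▹ g` is an automorphism, and g is recovered from τ and that automorphism.
  injSum-representatives : (A : W → W → Bool) (r : Vec W m) →
    injSum {m} m (λ g → ⟦ hom? (adj H) A (Vec.map (lookup r) g) ⟧)
      ≡ automorphisms H * ∑ᴸ (representatives H) (λ τ → ⟦ hom? (relabel H τ) A r ⟧)
  injSum-representatives A r = begin
    ∑ᵛ m (λ g → ⟦ unique? g ⟧ * pulled g)
      ≡⟨ ∑ᵛ-cong m spread ⟩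
    ∑ᵛ m (λ g → ∑ᴸ reps (λ τ → contained τ * (⟦ unique? (τ ▹ g) ⟧ * ⟦ automorphic? H (τ ▹ g) ⟧)))
      ≡⟨ ∑ᵛ-∑ᴸ m reps (λ τ g → contained τ * (⟦ unique? (τ ▹ g) ⟧ * ⟦ automorphic? H (τ ▹ g) ⟧)) ⟩
    ∑ᴸ reps (λ τ → ∑ᵛ m (λ g → contained τ * (⟦ unique? (τ ▹ g) ⟧ * ⟦ automorphic? H (τ ▹ g) ⟧)))
      ≡⟨ ∑ᴸ-cong reps (λ τ → trans
           -- The term depends on g only through `τ ▹ g`, which runs over all vectors as g does.
           (∑ᵛ-permute m τ (λ g → contained τ * (⟦ unique? g ⟧ * ⟦ automorphic? H g ⟧)))
           (trans (∑ᵛ-* m (contained τ) (λ g → ⟦ unique? g ⟧ * ⟦ automorphic? H g ⟧))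
             (ℕ.*-comm (contained τ) (automorphisms H)))) ⟩
    ∑ᴸ reps (λ τ → automorphisms H * contained τ)
      ≡⟨ ∑ᴸ-* (automorphisms H) reps contained ⟩
    automorphisms H * ∑ᴸ reps contained ∎
    where
    reps : List (Permutation′ m)
    reps = representatives H

    contained : Permutation′ m → ℕ
    contained τ = ⟦ hom? (relabel H τ) A r ⟧

    pulled : Vec (Fin m) m → ℕ
    pulled g = ⟦ hom? (adj H) A (Vec.map (lookup r) g) ⟧

    spread : ∀ g → ⟦ unique? g ⟧ * pulled g
      ≡ ∑ᴸ reps (λ τ → contained τ * (⟦ unique? (τ ▹ g) ⟧ * ⟦ automorphic? H (τ ▹ g) ⟧))
    spread g = begin
      ⟦ unique? g ⟧ * pulled g
        ≡⟨ ⟦⟧*-cong (unique? g) (λ u → trans (sym (ℕ.*-identityʳ (pulled g)))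
             (cong (pulled g *_) (sym (representatives-unique g u)))) ⟩
      ⟦ unique? g ⟧ * (pulled g * ∑ᴸ reps (λ τ → ⟦ automorphic? H (τ ▹ g) ⟧))
        ≡⟨ cong (⟦ unique? g ⟧ *_) (∑ᴸ-* (pulled g) reps _) ⟨
      ⟦ unique? g ⟧ * ∑ᴸ reps (λ τ → pulled g * ⟦ automorphic? H (τ ▹ g) ⟧)
        ≡⟨ ∑ᴸ-* ⟦ unique? g ⟧ reps _ ⟨
      ∑ᴸ reps (λ τ → ⟦ unique? g ⟧ * (pulled g * ⟦ automorphic? H (τ ▹ g) ⟧))
        ≡⟨ ∑ᴸ-cong reps term ⟩
      ∑ᴸ reps (λ τ → contained τ * (⟦ unique? (τ ▹ g) ⟧ * ⟦ automorphic? H (τ ▹ g) ⟧)) ∎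
      where
      term : ∀ τ → ⟦ unique? g ⟧ * (pulled g * ⟦ automorphic? H (τ ▹ g) ⟧)
        ≡ contained τ * (⟦ unique? (τ ▹ g) ⟧ * ⟦ automorphic? H (τ ▹ g) ⟧)
      term τ = begin
        ⟦ unique? g ⟧ * (pulled g * ⟦ automorphic? H (τ ▹ g) ⟧)
          ≡⟨ ⟦⟧*-cong (unique? g) (λ u → trans (ℕ.*-comm (pulled g) _) (trans
               (⟦⟧*-cong (automorphic? H (τ ▹ g)) (automorphic⇒hom⇔ A r g u τ))
               (ℕ.*-comm _ (contained τ)))) ⟩
        ⟦ unique? g ⟧ * (contained τ * ⟦ automorphic? H (τ ▹ g) ⟧)
          ≡⟨ x*[y*z]≡y*[x*z] ⟦ unique? g ⟧ (contained τ) _ ⟩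
        contained τ * (⟦ unique? g ⟧ * ⟦ automorphic? H (τ ▹ g) ⟧)
          ≡⟨ cong (λ u → contained τ * (u * ⟦ automorphic? H (τ ▹ g) ⟧))
               (unique-map (permutation-injective τ) g) ⟨
        contained τ * (⟦ unique? (τ ▹ g) ⟧ * ⟦ automorphic? H (τ ▹ g) ⟧) ∎

-- Polynomials at points with coordinates 0 and 1

allTrue? : (b : V → Bool) (μ : Monomial V) → Dec (Allᴸ (T ∘ b) μ)
allTrue? b = Allᴸ.all? (T? ∘ b)

-- The value at a point with coordinates 0 and 1, computed in ℕ: there each monomial is 0 or 1.
count : (V → Bool) → Polynomial V → ℕ
count b p = ∑ᴸ p (λ μ → ⟦ allTrue? b μ ⟧)

allTrue-∷ : (b : V → Bool) (v : V) (μ : Monomial V) →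
  ⟦ allTrue? b (v ∷ μ) ⟧ ≡ ⟦ T? (b v) ⟧ * ⟦ allTrue? b μ ⟧
allTrue-∷ b v μ = ⟦⟧-× (allTrue? b (v ∷ μ)) (T? (b v)) (allTrue? b μ)
  Allᴸ.uncons (λ (p , ps) → p ∷ ps)

-- A variable that is set to 0 behaves like a missing edge, whence the default `false`.
count-substitute : (s : V → Maybe U) (b : U → Bool) (p : Polynomial V) →
  count b (substitute s p) ≡ count (maybe b false ∘ s) p
count-substitute {V} {U} s b []      = refl
count-substitute {V} {U} s b (μ ∷ p) = trans (first (substituteMonomial s μ))
  (cong₂ _+_ (monomials μ) (count-substitute s b p))
  where
  value′ : Maybe (Monomial U) → ℕ
  value′ = maybe (λ ν → ⟦ allTrue? b ν ⟧) 0

  first : ∀ ν → count b (List.catMaybes (ν ∷ List.map (substituteMonomial s) p))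
    ≡ value′ ν + count b (substitute s p)
  first (just _) = refl
  first nothing  = refl

  monomials : ∀ μ → value′ (substituteMonomial s μ) ≡ ⟦ allTrue? (maybe b false ∘ s) μ ⟧
  monomials []      = refl
  monomials (v ∷ μ) = trans (product (s v) (substituteMonomial s μ))
    (trans (cong (⟦ T? (maybe b false (s v)) ⟧ *_) (monomials μ))
      (sym (allTrue-∷ (maybe b false ∘ s) v μ)))
    where
    product : ∀ u ν → value′ (zipWith _∷_ u ν) ≡ ⟦ T? (maybe b false u) ⟧ * value′ ν
    product (just u) (just ν) = allTrue-∷ b u ν
    product (just u) nothing  = sym (ℕ.*-zeroʳ ⟦ T? (b u) ⟧)
    product nothing  _        = refl

-- X on the index set ℕ, with no edges at the indices ≥ n.
extend : Graph n → ℕ → ℕ → Bool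
extend {n} X i j = maybe (uncurry (adj X)) false (keepVariable n (i , j))

extend-sym : (X : Graph n) (i j : ℕ) → extend X i j ≡ extend X j i
extend-sym {n} X i j with i ℕ.<? n | j ℕ.<? n
... | yes _ | yes _ = adj-sym X _ _
... | yes _ | no _  = refl
... | no _  | yes _ = refl
... | no _  | no _  = refl

extend-toℕ : (X : Graph n) (i j : Fin n) → extend X (toℕ i) (toℕ j) ≡ adj X i j
extend-toℕ {n} X i j with toℕ i ℕ.<? n | toℕ j ℕ.<? n
... | yes p | yes q = cong₂ (adj X) (fromℕ<-toℕ i p) (fromℕ<-toℕ j q)
... | no ¬p | _     = contradiction (toℕ<n i) ¬p
... | yes _ | no ¬q = contradiction (toℕ<n j) ¬q

-- The variables of the monomial are the edges of `relabel H σ`, listed with i < j; the symmetry of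
-- A and the absence of loops in H take care of the other ordered pairs.
allTrue-monomial : (H : Graph m) (A : ℕ → ℕ → Bool) → (∀ a b → A a b ≡ A b a) →
  (r : Vec ℕ m) (σ : Permutation′ m) →
  ⟦ allTrue? (uncurry A) (monomial H r σ) ⟧ ≡ ⟦ hom? (relabel H σ) A r ⟧
allTrue-monomial {m} H A A-sym r σ =
  ⟦⟧-cong (allTrue? (uncurry A) (monomial H r σ)) (hom? (relabel H σ) A r) to from
  where
  factor : Fin m × Fin m → Monomial (ℕ × ℕ)
  factor (i , j) = List.replicate (entry H (act σ (i , j))) (lookup r i , lookup r j)

  upper : Allᴸ (T ∘ uncurry A) (monomial H r σ) → ∀ {i j} → i Fin.< j →
    T (relabel H σ i j) → T (A (lookup r i) (lookup r j))
  upper all {i} {j} i<j b = Allᴸ.head (subst (Allᴸ (T ∘ uncurry A))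
    (cong (λ e → List.replicate e (lookup r i , lookup r j))
      (trans (entry-act H σ i j) (⟦⟧-yes (T? (relabel H σ i j)) b)))
    (Allᴸ.lookup (Allᴸ.map⁻ {f = factor} (Allᴸ.concat⁻ {xss = List.map factor (pairs m)} all))
      (<⇒∈-pairs i<j)))

  to : Allᴸ (T ∘ uncurry A) (monomial H r σ) → Hom (relabel H σ) A r
  to all i j b with Fin.<-cmp i j
  ... | tri< i<j _ _  = upper all i<j b
  ... | tri≈ _ refl _ = contradiction b (subst (¬_ ∘ T) (sym (adj-irrefl H (σ ⟨$⟩ʳ i))) λ ())
  ... | tri> _ _ j<i  = subst T (A-sym _ _) (upper all j<i (subst T (adj-sym H _ _) b))

  from : Hom (relabel H σ) A r → Allᴸ (T ∘ uncurry A) (monomial H r σ)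
  from h = Allᴸ.concat⁺ (Allᴸ.map⁺ (Allᴸ.universal (λ (i , j) →
    subst (λ e → Allᴸ (T ∘ uncurry A) (List.replicate e (lookup r i , lookup r j)))
      (sym (entry-act H σ i j)) (power i j (T? (relabel H σ i j))))
    (pairs m)))
    where
    power : ∀ i j (b? : Dec (T (relabel H σ i j))) →
      Allᴸ (T ∘ uncurry A) (List.replicate ⟦ b? ⟧ (lookup r i , lookup r j))
    power i j (yes b) = h i j b ∷ []
    power i j (no _)  = []

-- Copies of a graph and injective homomorphisms

∑ᴸ-upTo-suc : ∀ n (φ : ℕ → ℕ) → ∑ᴸ (List.upTo (suc n)) φ ≡ ∑ᴸ (List.upTo n) φ + φ n
∑ᴸ-upTo-suc n φ = begin
  ∑ᴸ (List.upTo (suc n)) φ            ≡⟨ cong (λ xs → ∑ᴸ xs φ) (upTo-∷ʳ n) ⟨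
  ∑ᴸ (List.upTo n List.∷ʳ n) φ        ≡⟨ ∑ᴸ-++ (List.upTo n) (n ∷ []) φ ⟩
  ∑ᴸ (List.upTo n) φ + (φ n + 0)      ≡⟨ cong (∑ᴸ (List.upTo n) φ +_) (ℕ.+-identityʳ (φ n)) ⟩
  ∑ᴸ (List.upTo n) φ + φ n            ∎

-- Increasing sequences are grouped by their last entry N, as in the definition of `ℳ`.
∑ᴸ-increasing : ∀ m n (φ : Vec ℕ (suc m) → ℕ) →
  ∑ᴸ (List.upTo n) (λ N → ∑ᴸ (List.map (Vec._∷ʳ N) (increasing m N)) φ) ≡ ∑ᴸ (increasing (suc m) n) φ
∑ᴸ-increasing m zero    φ = refl
∑ᴸ-increasing m (suc n) φ = begin
  ∑ᴸ (List.upTo (suc n)) part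
    ≡⟨ ∑ᴸ-upTo-suc n part ⟩
  ∑ᴸ (List.upTo n) part + part n
    ≡⟨ cong (_+ part n) (∑ᴸ-increasing m n φ) ⟩
  ∑ᴸ (increasing (suc m) n) φ + part n
    ≡⟨ ∑ᴸ-++ (increasing (suc m) n) _ φ ⟨
  ∑ᴸ (increasing (suc m) (suc n)) φ ∎
  where
  part : ℕ → ℕ
  part N = ∑ᴸ (List.map (Vec._∷ʳ N) (increasing m N)) φ

-- The value of `𝒫 n H` at X as a natural number. For H on at least two vertices it is the number of
-- subgraphs of X, not necessarily induced, that are isomorphic to H.
copies : Graph m → Graph n → ℕ
copies {n = n} H X = count (uncurry (adj X)) (𝒫 n H)

copies-extend : (H : Graph m) (X : Graph n) →
  copies H X ≡ ∑ᴸ (List.upTo n) (λ N → count (uncurry (extend X)) (ℳ H N))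
copies-extend {n = n} H X = trans
  (∑ᴸ-concatMap (λ N → substitute (keepVariable n) (ℳ H N)) (List.upTo n) _)
  (∑ᴸ-cong (List.upTo n) λ N → count-substitute (keepVariable n) (uncurry (adj X)) (ℳ H N))

-- The monomial of the one-vertex graph is empty and does not see the edges of X and Y.
copies-vertex : (H : Graph 1) (X Y : Graph n) → copies H X ≡ copies H Y
copies-vertex {n} H X Y = trans (copies-extend H X)
  (trans (∑ᴸ-cong (List.upTo n) constant) (sym (copies-extend H Y)))
  where
  constant : ∀ N → count (uncurry (extend X)) (ℳ H N) ≡ count (uncurry (extend Y)) (ℳ H N)
  constant zero    = refl
  constant (suc N) = refl

injectiveHomWeight : (Fin m → Fin m → Bool) → Weight m
injectiveHomWeight B Z f = ⟦ unique? f ⟧ * ⟦ hom? B (adj Z) f ⟧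

injectiveHomWeight-natural : (B : Fin m → Fin m → Bool) → Natural (injectiveHomWeight B)
injectiveHomWeight-natural B Z X ρ inj emb f =
  cong₂ _*_ (sym (unique-map inj f)) (homWeight-natural B Z X ρ inj emb f)

injectiveHoms : Graph m → Graph n → ℕ
injectiveHoms {m} H X = ∑ᵛ m (injectiveHomWeight (adj H) X)

-- An injective map is its sorted image r together with a permutation of `Fin m`; for fixed r, the
-- sum over the permutations is reduced to the representatives, each counted once per automorphism.
injectiveHoms≡ : 2 ≤ m → (H : Graph m) (X : Graph n) →
  injectiveHoms H X ≡ automorphisms H * copies H X
injectiveHoms≡ {2+k@(suc (suc k))} {n} (s≤s (s≤s _)) H X = begin
  injSum {n} 2+k (λ f → ⟦ hom? (adj H) (adj X) f ⟧)
    ≡⟨ injSum-cong 2+k (λ f → ⟦⟧-cong (hom? (adj H) (adj X) f) (hom? (adj H) (extend X) (Vec.map toℕ f))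
         (λ h i j b → subst T (sym (extended f i j)) (h i j b))
         (λ h i j b → subst T (extended f i j) (h i j b))) ⟩
  injSum {n} 2+k (λ f → ⟦ hom? (adj H) (extend X) (Vec.map toℕ f) ⟧)
    ≡⟨ injSum-increasing 2+k n (λ w → ⟦ hom? (adj H) (extend X) w ⟧) ⟩
  ∑ᴸ (increasing 2+k n) (λ r → injSum {2+k} 2+k (λ g → ⟦ hom? (adj H) (extend X) (Vec.map (lookup r) g) ⟧))
    ≡⟨ ∑ᴸ-cong (increasing 2+k n) (injSum-representatives H (extend X)) ⟩
  ∑ᴸ (increasing 2+k n) (λ r → automorphisms H * placed r)
    ≡⟨ ∑ᴸ-* (automorphisms H) (increasing 2+k n) placed ⟩
  automorphisms H * ∑ᴸ (increasing 2+k n) placed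
    ≡⟨ cong (automorphisms H *_) (sym copies-placed) ⟩
  automorphisms H * copies H X ∎
  where
  extended : ∀ (f : Vec (Fin n) 2+k) i j →
    extend X (lookup (Vec.map toℕ f) i) (lookup (Vec.map toℕ f) j) ≡ adj X (lookup f i) (lookup f j)
  extended f i j = trans (cong₂ (extend X) (lookup-map i toℕ f) (lookup-map j toℕ f)) (extend-toℕ X _ _)

  placed : Vec ℕ 2+k → ℕ
  placed r = ∑ᴸ (representatives H) (λ σ → ⟦ hom? (relabel H σ) (extend X) r ⟧)

  placed-monomials : ∀ r →
    count (uncurry (extend X)) (List.map (monomial H r) (representatives H)) ≡ placed r
  placed-monomials r = trans (∑ᴸ-map (monomial H r) (representatives H) _)
    (∑ᴸ-cong (representatives H) (allTrue-monomial H (extend X) (extend-sym X) r))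

  copies-placed : copies H X ≡ ∑ᴸ (increasing 2+k n) placed
  copies-placed = begin
    copies H X
      ≡⟨ copies-extend H X ⟩
    ∑ᴸ (List.upTo n) (λ N → count (uncurry (extend X)) (ℳ H N))
      ≡⟨ ∑ᴸ-cong (List.upTo n) (λ N → trans
           (∑ᴸ-concatMap (λ r → List.map (monomial H r) (representatives H))
             (List.map (Vec._∷ʳ N) (increasing (suc k) N)) _)
           (∑ᴸ-cong (List.map (Vec._∷ʳ N) (increasing (suc k) N)) placed-monomials)) ⟩
    ∑ᴸ (List.upTo n) (λ N → ∑ᴸ (List.map (Vec._∷ʳ N) (increasing (suc k) N)) placed)
      ≡⟨ ∑ᴸ-increasing (suc k) n placed ⟩
    ∑ᴸ (increasing 2+k n) placed ∎

-- Kelly's lemma applies to injective homomorphisms, and the number of automorphisms is not 0 and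
-- cancels. One vertex is treated apart because `ℳ` is then given by a convention.
copies-reconstructible : 1 ≤ m → m ≤ n → (H : Graph m) {X Y : Graph (suc n)} →
  SameDeckSums X Y → copies H X ≡ copies H Y
copies-reconstructible {suc zero}    _ _   H {X} {Y} same = copies-vertex H X Y
copies-reconstructible {suc (suc k)} _ m≤n H {X} {Y} same =
  ℕ.*-cancelˡ-≡ _ _ (automorphisms H) {{ ≢-nonZero (automorphisms≢0 H) }} (begin
    automorphisms H * copies H X  ≡⟨ injectiveHoms≡ (s≤s (s≤s z≤n)) H X ⟨
    injectiveHoms H X
      ≡⟨ kelly-small (injectiveHomWeight (adj H)) (injectiveHomWeight-natural (adj H)) m≤n same ⟩
    injectiveHoms H Y             ≡⟨ injectiveHoms≡ (s≤s (s≤s z≤n)) H Y ⟩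
    automorphisms H * copies H Y  ∎)

injectiveHoms-self≢0 : (X : Graph n) → injectiveHoms X X ≢ 0
injectiveHoms-self≢0 {n} X = ∑ᵛ-≢0 (injectiveHomWeight (adj X) X) (Vec.allFin n)
  (subst (_≢ 0) (sym (cong₂ _*_ (⟦⟧-yes (unique? (Vec.allFin n)) unique-allFin)
    (⟦⟧-yes (hom? (adj X) (adj X) (Vec.allFin n)) (identity-hom X)))) λ ())

injectiveHoms≢0⇒bijective-hom : (X Y : Graph n) → injectiveHoms X Y ≢ 0 →
  Σ (Permutation′ n) λ π → ∀ i j → Adjacent X i j → Adjacent Y (π ⟨$⟩ʳ i) (π ⟨$⟩ʳ j)
injectiveHoms≢0⇒bijective-hom {n} X Y homs≢0 =
  bijection (∑ᵛ-witness n (injectiveHomWeight (adj X) Y) homs≢0)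
  where
  bijection : (∃ λ f → injectiveHomWeight (adj X) Y f ≢ 0) →
    Σ (Permutation′ n) λ π → ∀ i j → Adjacent X i j → Adjacent Y (π ⟨$⟩ʳ i) (π ⟨$⟩ʳ j)
  bijection (f , ≢0) =
    let π , π≗ = unique⇒permutation f (⟦⟧-witness (unique? f) (*≢0ˡ ≢0))
    in π , λ i j ij → subst T (sym (cong₂ (adj Y) (π≗ i) (π≗ j)))
         (⟦⟧-witness (hom? (adj X) (adj Y) f) (*≢0ʳ ⟦ unique? f ⟧ ≢0) i j ij)

copies-self≢0 : 2 ≤ n → (X : Graph n) → copies X X ≢ 0
copies-self≢0 2≤n X copies≡0 = injectiveHoms-self≢0 X (trans (injectiveHoms≡ 2≤n X X)
  (trans (cong (automorphisms X *_) copies≡0) (ℕ.*-zeroʳ (automorphisms X))))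

copies≢0⇒injectiveHoms≢0 : 2 ≤ n → (X Y : Graph n) → copies X Y ≢ 0 → injectiveHoms X Y ≢ 0
copies≢0⇒injectiveHoms≢0 2≤n X Y copies≢0 eq = [ automorphisms≢0 X , copies≢0 ]′
  (ℕ.m*n≡0⇒m≡0∨n≡0 (automorphisms X) (trans (sym (injectiveHoms≡ 2≤n X Y)) eq))

-- Values in the field

module _ {c ℓ} (K : CommutativeRing c ℓ) where
  open CommutativeRing K using (_≈_; 1#; 0#)
    renaming (_+_ to _+ᴷ_; _*_ to _*ᴷ_; +-cong to +ᴷ-cong; +-identityʳ to +ᴷ-identityʳ;
              *-identityˡ to *ᴷ-identityˡ; zeroˡ to zeroᴷˡ; refl to ≈-refl; sym to ≈-sym; trans to ≈-trans)
  open CommutativeRing K using (+-monoid)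
  open Mult +-monoid using (×-homo-+) renaming (_×_ to _·_)

  value≈copies : (H : Graph m) (X : Graph n) → value K (𝒫 n H) X ≈ copies H X · 1#
  value≈copies {n = n} H X = polynomial (𝒫 n H)
    where
    b : Fin n × Fin n → CommutativeRing.Carrier K
    b (i , j) = if adj X i j then 1# else 0#

    monomials : ∀ μ → List.foldr _*ᴷ_ 1# (List.map b μ) ≈ ⟦ allTrue? (uncurry (adj X)) μ ⟧ · 1#
    monomials [] = ≈-sym (+ᴷ-identityʳ 1#)
    monomials ((i , j) ∷ μ) with adj X i j
    ... | true  = ≈-trans (*ᴷ-identityˡ _) (monomials μ)
    ... | false = zeroᴷˡ _

    polynomial : ∀ p → value K p X ≈ count (uncurry (adj X)) p · 1#
    polynomial []      = ≈-refl
    polynomial (μ ∷ p) = ≈-trans (+ᴷ-cong (monomials μ) (polynomial p))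
      (≈-sym (×-homo-+ 1# ⟦ allTrue? (uncurry (adj X)) μ ⟧ (count (uncurry (adj X)) p)))

  copies≡⇒value≈ : (H : Graph m) (X Y : Graph n) → copies H X ≡ copies H Y →
    value K (𝒫 n H) X ≈ value K (𝒫 n H) Y
  copies≡⇒value≈ H X Y eq = ≈-trans (value≈copies H X)
    (≈-trans (CommutativeRing.reflexive K (cong (_· 1#) eq)) (≈-sym (value≈copies H Y)))

  -- In characteristic 0 a positive multiple of 1 is not 0, so equal values cannot come from one
  -- zero and one nonzero count.
  value≈⇒copies≢0 : CharacteristicZero K → (H : Graph m) (X Y : Graph n) →
    value K (𝒫 n H) X ≈ value K (𝒫 n H) Y → copies H X ≢ 0 → copies H Y ≢ 0
  value≈⇒copies≢0 char0 H X Y eq X≢0 Y≡0 = nonzero (copies H X) X≢0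
    (≈-trans (≈-sym (value≈copies H X)) (≈-trans eq
      (≈-trans (value≈copies H Y) (CommutativeRing.reflexive K (cong (_· 1#) Y≡0)))))
    where
    nonzero : ∀ a → a ≢ 0 → ¬ (a · 1# ≈ 0#)
    nonzero zero    a≢0 _  = a≢0 refl
    nonzero (suc a) _   a≈ = char0 a a≈

proposition5p2 : ∀ {c ℓ} (K : CommutativeRing c ℓ) → IsField K → CharacteristicZero K →
    let open CommutativeRing K using (_≈_) in
    ∀ (n : ℕ) → 3 ≤ n →
    (∀ (X Y : Graph n) →
    (∀ (m : ℕ) → 1 ≤ m → m ≤ n ∸ 1 → (H : Graph m) → WithoutIsolatedVertex H →
    value K (𝒫 n H) X ≈ value K (𝒫 n H) Y) →
    (∀ (G : Graph n) → Connected G → edgeCount G ≤ ⌊ n C 2 /2⌋ →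
    value K (𝒫 n G) X ≈ value K (𝒫 n G) Y)) →
    Reconstructible n
proposition5p2 K _ char0 (suc n) (s≤s 2≤n) deduced X Y sameVertexDeleted = reconstruct (few-edges X)
  where
  same : SameDeckSums X Y
  same = sameVertexDeleted⇒sameDeckSums {X = X} {Y} sameVertexDeleted

  2≤1+n : 2 ≤ suc n
  2≤1+n = ℕ.m≤n⇒m≤1+n 2≤n

  -- X and Y are quantified afresh here, so that the argument also applies to the complements.
  bijective-hom : ∀ X Y → SameDeckSums X Y → edgeCount X ≤ ⌊ suc n C 2 /2⌋ →
    Connected X ⊎ Separation X →
    Σ (Permutation′ (suc n)) λ π → ∀ i j → Adjacent X i j → Adjacent Y (π ⟨$⟩ʳ i) (π ⟨$⟩ʳ j)
  bijective-hom X Y same few (inj₁ connected) =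
    injectiveHoms≢0⇒bijective-hom X Y (copies≢0⇒injectiveHoms≢0 2≤1+n X Y
      (value≈⇒copies≢0 K char0 X X Y
        -- The hypothesis is applied with G = X. Its premise concerns graphs on at most n of the n +
        -- 1 vertices, the range of `copies-reconstructible`.
        (deduced X Y
          (λ m 1≤m m≤n H _ → copies≡⇒value≈ K H X Y (copies-reconstructible 1≤m m≤n H same))
          X connected few)
        (copies-self≢0 2≤1+n X)))
  bijective-hom X Y same few (inj₂ separation) =
    homCount⇒bijective-hom same (separation⇒homCount-reconstructible separation same)

  sparse : ∀ X Y → SameDeckSums X Y → edgeCount X ≤ ⌊ suc n C 2 /2⌋ → X ≅ Y
  sparse X Y same few =
    let π , hom = bijective-hom X Y same few (connected⊎separation X)
    in bijective-hom⇒≅ {X = X} {Y} (edgeSum-reconstructible 2≤n same) π hom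

  reconstruct : edgeCount X ≤ ⌊ suc n C 2 /2⌋ ⊎ edgeCount (complement X) ≤ ⌊ suc n C 2 /2⌋ → X ≅ Y
  reconstruct (inj₁ few) = sparse X Y same few
  reconstruct (inj₂ few) = ≅-of-complements {X = X} {Y}
    (sparse (complement X) (complement Y) (complement-same same) few)
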